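{- Let $\lambda \vdash 2$ and $\hat{\lambda} \vdash 3$ be partitions such that the pair $(\lambda,\hat{\lambda})$ is not one of $((2),(3))$, $((2),(2\,1))$, $((1^2),(2\,1))$. Let $\mathfrak{r} \subset \mathbb{K}[\mathcal{S}_2]$ be a minimal right ideal of class $\lambda$ and $\hat{\mathfrak{r}} \subset \mathbb{K}[\mathcal{S}_3]$ a minimal right ideal of class $\hat{\lambda}$. Then for all $T \in \mathcal{T}_{\mathfrak{r}} \subseteq \mathcal{T}_2 V$ and all $\hat{T} \in \mathcal{T}_{\hat{\mathfrak{r}}} \subseteq \mathcal{T}_3 V$ we have $$y_{t'}^{\ast}(T\otimes \hat{T}) = 0 \quad\text{and}\quad y_{t'}^{\ast}(\hat{T}\otimes T) = 0 .$$ Consequently, nonzero algebraic covariant derivative curvature tensors of the form $y_{t'}^{\ast}(T\otimes\hat T)$ or $y_{t'}^{\ast}(\hat T\otimes T)$ with $T,\hat T$ in symmetry classes defined by minimal right ideals can only arise when the classes of these ideals are given by one of the three pairs $((2),(3))$, $((2),(2\,1))$, $((1^2),(2\,1))$.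
   Context: $\mathbb{K}=\mathbb{R}$ or $\mathbb{C}$; $V$ is a finite-dimensional $\mathbb{K}$-vector space and $\mathcal{T}_r V$ the space of $r$-times covariant tensors (multilinear maps $V^r\to\mathbb{K}$). For $T\in\mathcal{T}_2V$, $\hat T\in\mathcal{T}_3V$, $(T\otimes\hat T)(v_1,\dots,v_5)=T(v_1,v_2)\hat T(v_3,v_4,v_5)$ and $(\hat T\otimes T)(v_1,\dots,v_5)=\hat T(v_1,v_2,v_3)T(v_4,v_5)$. Permutations multiply by $(p\circ q)(i)=p(q(i))$. An element $a=\sum_{p\in\mathcal{S}_r}a(p)\,p$ of the group ring $\mathbb{K}[\mathcal{S}_r]$ acts on $T\in\mathcal{T}_rV$ by $(aT)(v_1,\dots,v_r)=\sum_p a(p)\,T(v_{p(1)},\dots,v_{p(r)})$, and $a^{\ast}:=\sum_p a(p)\,p^{ -1}$. For a right ideal $\mathfrak{r}\subseteq\mathbb{K}[\mathcal{S}_r]$, the symmetry class is $\mathcal{T}_{\mathfrak{r}}=\{aT : a\in\mathfrak{r},\ T\in\mathcal{T}_rV\}$; if $e$ is a generating idempotent of $\mathfrak{r}$ then $\mathcal{T}_{\mathfrak r}=\{T: eT=T\}$. For a Young tableau $t$ with entries $1,\dots,r$, the Young symmetrizer is $y_t=\sum_{p\in\mathcal{H}_t}\sum_{q\in\mathcal{V}_t}\mathrm{sign}(q)\,p\circ q$, where $\mathcal{H}_t$ ($\mathcal{V}_t$) is the group of permutations preserving each row (column) of $t$. A minimal right ideal of $\mathbb{K}[\mathcal{S}_n]$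 is said to be of class $\lambda\vdash n$ if it is isomorphic (as right $\mathbb{K}[\mathcal{S}_n]$-module) to $y_t\,\mathbb{K}[\mathcal{S}_n]$ for a Young tableau $t$ of shape $\lambda$, equivalently if it lies in the minimal two-sided ideal of $\mathbb{K}[\mathcal{S}_n]$ corresponding to $\lambda$. Here $t'$ is the Young tableau with rows $(1,3,5)$ and $(2,4)$ (so columns $\{1,2\},\{3,4\},\{5\}$). An algebraic covariant derivative curvature tensor is a tensor $\mathfrak{R}'\in\mathcal{T}_5V$ with, for all $u,w,x,y,z\in V$: $\mathfrak R'(w,x,y,z,u)=-\mathfrak R'(w,x,z,y,u)=\mathfrak R'(y,z,w,x,u)$, $\mathfrak R'(w,x,y,z,u)+\mathfrak R'(w,y,z,x,u)+\mathfrak R'(w,z,x,y,u)=0$, and $\mathfrak R'(w,x,y,z,u)+\mathfrak R'(w,x,z,u,y)+\mathfrak R'(w,x,u,y,z)=0$. -}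

module Defs where

open import Algebra.Apartness.Bundles using (HeytingField)
open import Algebra.Bundles using (CommutativeRing; Ring; Semiring)
open import Algebra.Bundles.Raw using (RawRing)
open import Algebra.Module.Bundles using (Module)
open import Algebra.Module.Bundles.Raw using (RawRightModule)
import Algebra.Definitions.RawMonoid as RawMonoidDefs
import Algebra.Definitions.RawSemiring as RawSemiringDefs
import Algebra.Module.Morphism.Structures as ModuleMorphisms
import Algebra.Morphism.Structures as Morphisms
import Algebra.Properties.CommutativeMonoid.Sum as CMSum
import Algebra.Properties.Ring as RingProperties
import Algebra.Properties.Semiring.Sum as SemiringSum
open import Data.Bool.Base using (if_then_else_)
open import Data.Fin.Base using (Fin; zero; suc; toℕ; _↑ˡ_; _↑ʳ_; punchIn; splitAt; join)
import Data.Fin.Properties as Fin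
open import Data.Fin.Patterns using (0F; 1F; 2F; 3F; 4F)
open import Data.Fin.Permutation as Perm
  using (Permutation′; _⟨$⟩ʳ_; _∘ₚ_; flip; insert; remove)
  renaming (_≈_ to _≈ₚ_; id to idₚ)
open import Data.List.Base as List
  using (List; []; _∷_; length; lookup; allFin; cartesianProduct; concatMap; filter)
open import Data.List.Relation.Unary.All using (All; []; _∷_)
open import Data.List.Relation.Unary.Linked using (Linked; []; [-]; _∷_)
open import Data.Nat.Base as ℕ using (ℕ; zero; suc)
import Data.Nat.ListAction as ℕ
import Data.Nat.Properties as ℕ
open import Data.Product.Base using (Σ; ∃; ∃-syntax; _×_; _,_; proj₁; proj₂)
open import Data.Sum.Base using (_⊎_; inj₁; inj₂)
open import Data.Vec.Functional using (Vector; updateAt)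
  renaming ([] to []ᵥ; _∷_ to _∷ᵥ_)
open import Data.Vec.Functional.Properties using (updateAt-updates; updateAt-minimal)
open import Function.Base using (_∘_; const)
open import Function.Bundles using (_↔_; Inverse; mk↔ₛ′)
open import Level as Lv using (Level; _⊔_)
open import Relation.Binary.Core using (Rel)
open import Relation.Binary.PropositionalEquality as ≡ using (_≡_; _≢_)
open import Relation.Binary.Structures using (IsStrictPartialOrder)
import Relation.Binary.Reasoning.Setoid as SetoidReasoning
open import Relation.Nullary.Decidable using (Dec; yes; no; does; _×-dec_)
open import Relation.Nullary.Negation using (¬_; contradiction)

private
  variable
    c ℓ₁ ℓ₂ ℓ₃ ℓ m ℓm : Level

commutativeRing : HeytingField c ℓ₁ ℓ₂ → CommutativeRing c ℓ₁
commutativeRing K = record { isCommutativeRing = HeytingField.isCommutativeRing K }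

-- ℝ is characterised up to isomorphism as the Archimedean,
-- Cauchy-complete ordered field.  Comparability x < y ⊎ y < x is only
-- asked for x # y, so that the constructive reals qualify; classically
-- (# being ≉) this is trichotomy.
record IsRealField (K : HeytingField c ℓ₁ ℓ₂) ℓ₃ : Set (c ⊔ ℓ₁ ⊔ ℓ₂ ⊔ Lv.suc ℓ₃) where
  open HeytingField K
  open RawMonoidDefs (CommutativeRing.+-rawMonoid (commutativeRing K))
    using () renaming (_×_ to _·_)
  infix 4 _<_
  field
    _<_                  : Rel Carrier ℓ₃
    isStrictPartialOrder : IsStrictPartialOrder _≈_ _<_
    #⇒<⊎>                : ∀ {x y} → x # y → x < y ⊎ y < x
    <⇒#                  : ∀ {x y} → x < y → x # y
    +-monoˡ-<            : ∀ {x y} z → x < y → x + z < y + z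
    *-positive           : ∀ {x y} → 0# < x → 0# < y → 0# < x * y
    archimedean          : ∀ x → ∃[ n ] x < n · 1#

  IsCauchy : (ℕ → Carrier) → Set (c ⊔ ℓ₃)
  IsCauchy s = ∀ ε → 0# < ε →
    ∃[ N ] ∀ i j → N ℕ.≤ i → N ℕ.≤ j → s i - s j < ε

  _⟶_ : (ℕ → Carrier) → Carrier → Set (c ⊔ ℓ₃)
  s ⟶ x = ∀ ε → 0# < ε →
    ∃[ N ] ∀ i → N ℕ.≤ i → s i - x < ε × x - s i < ε

  field
    complete : ∀ s → IsCauchy s → ∃[ x ] s ⟶ x

complexRawRing : CommutativeRing c ℓ → RawRing c ℓ
complexRawRing R = record
  { Carrier = Carrier × Carrier
  ; _≈_     = λ (a , b) (a′ , b′) → a ≈ a′ × b ≈ b′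
  ; _+_     = λ (a , b) (a′ , b′) → a + a′ , b + b′
  ; _*_     = λ (a , b) (a′ , b′) → a * a′ - b * b′ , a * b′ + b * a′
  ; -_      = λ (a , b) → - a , - b
  ; 0#      = 0# , 0#
  ; 1#      = 1# , 0#
  }
  where open CommutativeRing R

record IsComplexField (K : HeytingField c ℓ₁ ℓ₂) ℓ₃ : Set (Lv.suc (c ⊔ ℓ₁ ⊔ ℓ₂ ⊔ ℓ₃)) where
  field
    realField   : HeytingField c ℓ₁ ℓ₂
    isRealField : IsRealField realField ℓ₃

  rawℂ : RawRing c ℓ₁
  rawℂ = complexRawRing (commutativeRing realField)

  open Morphisms.RingMorphisms rawℂ (CommutativeRing.rawRing (commutativeRing K))

  field
    fromℂ             : RawRing.Carrier rawℂ → HeytingField.Carrier K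
    isRingIsomorphism : IsRingIsomorphism fromℂ

IsRealOrComplex : HeytingField c ℓ₁ ℓ₂ → ∀ ℓ₃ → Set (Lv.suc (c ⊔ ℓ₁ ⊔ ℓ₂ ⊔ ℓ₃))
IsRealOrComplex K ℓ₃ = IsRealField K ℓ₃ ⊎ IsComplexField K ℓ₃

infixr 9 _∘′_

-- (p ∘′ q)(i) = p (q i), whereas _∘ₚ_ composes in diagrammatic order.
_∘′_ : ∀ {n} → Permutation′ n → Permutation′ n → Permutation′ n
p ∘′ q = q ∘ₚ p

infix 4 _≟ₚ_

_≟ₚ_ : ∀ {n} (p q : Permutation′ n) → Dec (p ≈ₚ q)
p ≟ₚ q = Fin.all? λ i → p ⟨$⟩ʳ i Fin.≟ q ⟨$⟩ʳ i

-- Every permutation occurs exactly once up to _≈ₚ_; see ∑-sift.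
permutations : ∀ n → List (Permutation′ n)
permutations zero    = idₚ ∷ []
permutations (suc n) =
  concatMap (λ j → List.map (insert zero j) (permutations n)) (allFin (suc n))

inversions : ∀ {n} → Permutation′ n → ℕ
inversions {n} p = length (filter
  (λ (i , j) → (i Fin.<? j) ×-dec (p ⟨$⟩ʳ j Fin.<? p ⟨$⟩ʳ i))
  (cartesianProduct (allFin n) (allFin n)))

record Partition (n : ℕ) : Set where
  field
    parts      : List ℕ
    positive   : All (0 ℕ.<_) parts
    decreasing : Linked ℕ._≥_ parts
    sums       : ℕ.sum parts ≡ n

Cell : ∀ {n} → Partition n → Set
Cell μ = Σ (Fin (length parts)) λ i → Fin (lookup parts i)
  where open Partition μ

-- The entries are 0, …, n-1 instead of 1, …, n.
record YoungTableau {n} (μ : Partition n) : Set where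
  field
    filling : Cell μ ↔ Fin n

  open Inverse filling public using () renaming (to to entry; from to cell)

module _ {n} {μ : Partition n} (t : YoungTableau μ) where

  row : Fin n → Fin (length (Partition.parts μ))
  row x = proj₁ (YoungTableau.cell t x)

  column : Fin n → ℕ
  column x = toℕ (proj₂ (YoungTableau.cell t x))

  PreservesRows : Permutation′ n → Set
  PreservesRows p = ∀ x → row (p ⟨$⟩ʳ x) ≡ row x

  PreservesColumns : Permutation′ n → Set
  PreservesColumns p = ∀ x → column (p ⟨$⟩ʳ x) ≡ column x

  preservesRows? : ∀ p → Dec (PreservesRows p)
  preservesRows? p = Fin.all? λ x → row (p ⟨$⟩ʳ x) Fin.≟ row x

  preservesColumns? : ∀ p → Dec (PreservesColumns p)
  preservesColumns? p = Fin.all? λ x → column (p ⟨$⟩ʳ x) ℕ.≟ column x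

  rowGroup : List (Permutation′ n)
  rowGroup = filter preservesRows? (permutations n)

  columnGroup : List (Permutation′ n)
  columnGroup = filter preservesColumns? (permutations n)

partition-3-2 : Partition 5
partition-3-2 = record
  { parts      = 3 ∷ 2 ∷ []
  ; positive   = ℕ.s≤s ℕ.z≤n ∷ ℕ.s≤s ℕ.z≤n ∷ []
  ; decreasing = ℕ.s≤s (ℕ.s≤s ℕ.z≤n) ∷ [-]
  ; sums       = ≡.refl
  }

-- Rows (1,3,5) and (2,4), shifted down by one.
tableau-135-24 : YoungTableau partition-3-2
tableau-135-24 = record { filling = mk↔ₛ′ to from
  (λ { 0F → ≡.refl ; 1F → ≡.refl ; 2F → ≡.refl ; 3F → ≡.refl ; 4F → ≡.refl })
  (λ { (0F , 0F) → ≡.refl ; (0F , 1F) → ≡.refl ; (0F , 2F) → ≡.refl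
     ; (1F , 0F) → ≡.refl ; (1F , 1F) → ≡.refl }) }
  where
  to : Cell partition-3-2 → Fin 5
  to (0F , 0F) = 0F
  to (0F , 1F) = 2F
  to (0F , 2F) = 4F
  to (1F , 0F) = 1F
  to (1F , 1F) = 3F

  from : Fin 5 → Cell partition-3-2
  from 0F = 0F , 0F
  from 1F = 1F , 0F
  from 2F = 0F , 1F
  from 3F = 1F , 1F
  from 4F = 0F , 2F

AdmissiblePair : Partition 2 → Partition 3 → Set
AdmissiblePair μ ν =
    (parts μ ≡ 2 ∷ []     × parts ν ≡ 3 ∷ [])
  ⊎ (parts μ ≡ 2 ∷ []     × parts ν ≡ 2 ∷ 1 ∷ [])
  ⊎ (parts μ ≡ 1 ∷ 1 ∷ [] × parts ν ≡ 2 ∷ 1 ∷ [])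
  where open Partition

module _ (R : Ring c ℓ) where
  open Ring R

  record RightIdeal ℓ₃ : Set (c ⊔ ℓ ⊔ Lv.suc ℓ₃) where
    field
      Member    : Carrier → Set ℓ₃
      resp      : ∀ {x y} → x ≈ y → Member x → Member y
      0#-closed : Member 0#
      +-closed  : ∀ {x y} → Member x → Member y → Member (x + y)
      -‿closed  : ∀ {x} → Member x → Member (- x)
      *-closed  : ∀ {x} → Member x → ∀ y → Member (x * y)

    rawRightModule : RawRightModule Carrier (c ⊔ ℓ₃) ℓ
    rawRightModule = record
      { Carrierᴹ = ∃ Member
      ; _≈ᴹ_     = λ (x , _) (y , _) → x ≈ y
      ; _+ᴹ_     = λ (x , p) (y , q) → x + y , +-closed p q
      ; _*ᵣ_     = λ (x , p) y → x * y , *-closed p y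
      ; 0ᴹ       = 0# , 0#-closed
      ; -ᴹ_      = λ (x , p) → - x , -‿closed p
      }

  principal : Carrier → RightIdeal (c ⊔ ℓ)
  principal a = record
    { Member    = λ x → ∃[ b ] x ≈ a * b
    ; resp      = λ { x≈y (b , eq) → b , trans (sym x≈y) eq }
    ; 0#-closed = 0# , sym (zeroʳ a)
    ; +-closed  = λ { (b , eq) (b′ , eq′) →
                      b + b′ , trans (+-cong eq eq′) (sym (distribˡ a b b′)) }
    ; -‿closed  = λ { (b , eq) →
                      - b , trans (-‿cong eq) (RingProperties.-‿distribʳ-* R a b) }
    ; *-closed  = λ { (b , eq) y → b * y , trans (*-congʳ eq) (*-assoc a b y) }
    }

module _ {R : Ring c ℓ} {ℓ₃ ℓ₄ : Level} where

  infix 4 _≅_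

  _≅_ : RightIdeal R ℓ₃ → RightIdeal R ℓ₄ → Set (c ⊔ ℓ ⊔ ℓ₃ ⊔ ℓ₄)
  I ≅ J = ∃ IsRightModuleIsomorphism
    where open ModuleMorphisms.RightModuleMorphisms
                 (RightIdeal.rawRightModule I) (RightIdeal.rawRightModule J)

module GroupRing (K : HeytingField c ℓ₁ ℓ₂) where
  open HeytingField K using (_#_)
  open CommutativeRing (commutativeRing K) hiding (zero)
  open RawSemiringDefs (Semiring.rawSemiring semiring) using (_^_)
  open SemiringSum semiring
    using (sum; sum-cong-≋; ∑-distrib-+; ∑-comm; *-distribˡ-sum; *-distribʳ-sum)
  open SetoidReasoning setoid

  private
    variable
      a b : Level
      A B : Set a

  ∑ : List A → (A → Carrier) → Carrier
  ∑ xs f = sum (f ∘ lookup xs)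

  syntax ∑ xs (λ x → e) = ∑[ x ∈ xs ] e

  infixl 10 ∑

  [_] : Dec A → Carrier
  [ d ] = if does d then 1# else 0#

  ∑-cong : ∀ (xs : List A) {f g : A → Carrier} → (∀ x → f x ≈ g x) → ∑ xs f ≈ ∑ xs g
  ∑-cong xs f≈g = sum-cong-≋ (λ i → f≈g (lookup xs i))

  ∑-zero : ∀ (xs : List A) → ∑ xs (const 0#) ≈ 0#
  ∑-zero []       = refl
  ∑-zero (x ∷ xs) = trans (+-identityˡ _) (∑-zero xs)

  ∑-++ : ∀ (xs ys : List A) f → ∑ (xs List.++ ys) f ≈ ∑ xs f + ∑ ys f
  ∑-++ []       ys f = sym (+-identityˡ _)
  ∑-++ (x ∷ xs) ys f = trans (+-congˡ (∑-++ xs ys f)) (sym (+-assoc _ _ _))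

  ∑-map : ∀ (g : A → B) xs f → ∑ (List.map g xs) f ≈ ∑ xs (f ∘ g)
  ∑-map g []       f = refl
  ∑-map g (x ∷ xs) f = +-congˡ (∑-map g xs f)

  ∑-concatMap : ∀ (g : A → List B) xs f →
                ∑ (concatMap g xs) f ≈ ∑[ x ∈ xs ] ∑ (g x) f
  ∑-concatMap g []       f = refl
  ∑-concatMap g (x ∷ xs) f =
    trans (∑-++ (g x) (concatMap g xs) f) (+-congˡ (∑-concatMap g xs f))

  ∑-tabulate : ∀ {n} (g : Fin n → A) f → ∑ (List.tabulate g) f ≈ sum (f ∘ g)
  ∑-tabulate {n = zero}  g f = refl
  ∑-tabulate {n = suc n} g f = +-congˡ (∑-tabulate (g ∘ suc) f)

  []-true : (d : Dec A) → A → [ d ] ≈ 1#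
  []-true (yes _) _ = refl
  []-true (no ¬p) p = contradiction p ¬p

  []-false : (d : Dec A) → ¬ A → [ d ] ≈ 0#
  []-false (yes p) ¬p = contradiction p ¬p
  []-false (no _)  _  = refl

  []-cong : (d : Dec A) (e : Dec B) → (A → B) → (B → A) → [ d ] ≈ [ e ]
  []-cong (yes p) e to from = sym ([]-true e (to p))
  []-cong (no ¬p) e to from = sym ([]-false e (¬p ∘ from))

  []-× : (d : Dec A) (e : Dec B) → [ d ×-dec e ] ≈ [ d ] * [ e ]
  []-× (yes _) (yes _) = sym (*-identityˡ _)
  []-× (yes _) (no _)  = sym (*-identityˡ _)
  []-× (no _)  e       = sym (zeroˡ _)

  sum-zero : ∀ n → sum {n} (const 0#) ≈ 0#
  sum-zero zero    = refl
  sum-zero (suc n) = trans (+-identityˡ _) (sum-zero n)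

  sum-sift : ∀ {n} (i : Fin n) (f : Fin n → Carrier) →
             sum (λ j → [ j Fin.≟ i ] * f j) ≈ f i
  sum-sift {suc n} zero f = begin
    1# * f zero + sum (λ j → 0# * f (suc j))
      ≈⟨ +-cong (*-identityˡ _) (sum-cong-≋ {n} (λ j → zeroˡ (f (suc j)))) ⟩
    f zero + sum {n} (const 0#)  ≈⟨ +-congˡ (sum-zero n) ⟩
    f zero + 0#                  ≈⟨ +-identityʳ _ ⟩
    f zero                       ∎
  sum-sift {suc n} (suc i) f = begin
    0# * f zero + sum (λ j → [ suc j Fin.≟ suc i ] * f (suc j))
      ≈⟨ +-cong (zeroˡ _) (sum-cong-≋ {n} (λ j → *-congʳ
           ([]-cong (suc j Fin.≟ suc i) (j Fin.≟ i) Fin.suc-injective (≡.cong suc)))) ⟩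
    0# + sum (λ j → [ j Fin.≟ i ] * f (suc j))  ≈⟨ +-identityˡ _ ⟩
    sum (λ j → [ j Fin.≟ i ] * f (suc j))       ≈⟨ sum-sift i (f ∘ suc) ⟩
    f (suc i)                                   ∎

  Respects : ∀ {n} → (Permutation′ n → Carrier) → Set ℓ₁
  Respects f = ∀ p q → p ≈ₚ q → f p ≈ f q

  insert-cong : ∀ {n} (j : Fin (suc n)) (p q : Permutation′ n) →
                p ≈ₚ q → insert zero j p ≈ₚ insert zero j q
  insert-cong j p q p≈q zero    = ≡.refl
  insert-cong j p q p≈q (suc k) = ≡.cong (punchIn j) (p≈q k)

  insert-≈⇒ : ∀ {n} (j : Fin (suc n)) (p : Permutation′ n) q → insert zero j p ≈ₚ q →
              j ≡ q ⟨$⟩ʳ zero × p ≈ₚ remove zero q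
  insert-≈⇒ j p q eq = eq zero , λ k → Fin.punchIn-injective j _ _
    (≡.trans (eq (suc k))
    (≡.trans (Perm.punchIn-permute q zero k)
             (≡.cong (λ i → punchIn i (remove zero q ⟨$⟩ʳ k)) (≡.sym (eq zero)))))

  insert-≈⇐ : ∀ {n} (j : Fin (suc n)) (p : Permutation′ n) q →
              j ≡ q ⟨$⟩ʳ zero × p ≈ₚ remove zero q → insert zero j p ≈ₚ q
  insert-≈⇐ j p q (≡.refl , p≈) i =
    ≡.trans (insert-cong j p (remove zero q) p≈ i) (Perm.insert-remove zero q i)

  ∑-sift : ∀ {n} (p : Permutation′ n) (f : Permutation′ n → Carrier) → Respects f →
           ∑[ q ∈ permutations n ] ([ q ≟ₚ p ] * f q) ≈ f p
  ∑-sift {zero} p f resp = begin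
    [ idₚ ≟ₚ p ] * f idₚ + 0#  ≈⟨ +-identityʳ _ ⟩
    [ idₚ ≟ₚ p ] * f idₚ       ≈⟨ *-cong ([]-true (idₚ ≟ₚ p) λ ()) (resp idₚ p λ ()) ⟩
    1# * f p                   ≈⟨ *-identityˡ _ ⟩
    f p                        ∎
  ∑-sift {suc n} p f resp = begin
    ∑[ q ∈ permutations (suc n) ] ([ q ≟ₚ p ] * f q)
      ≈⟨ ∑-concatMap S (allFin (suc n)) F ⟩
    ∑[ j ∈ allFin (suc n) ] ∑ (S j) F
      ≈⟨ ∑-tabulate {n = suc n} (λ j → j) (λ j → ∑ (S j) F) ⟩
    sum (λ j → ∑ (S j) F)
      ≈⟨ sum-cong-≋ step ⟩
    sum (λ j → [ j Fin.≟ p ⟨$⟩ʳ zero ] * f (insert zero j (remove zero p)))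
      ≈⟨ sum-sift (p ⟨$⟩ʳ zero) (λ j → f (insert zero j (remove zero p))) ⟩
    f (insert zero (p ⟨$⟩ʳ zero) (remove zero p))
      ≈⟨ resp (insert zero (p ⟨$⟩ʳ zero) (remove zero p)) p (Perm.insert-remove zero p) ⟩
    f p ∎
    where
    S : Fin (suc n) → List (Permutation′ (suc n))
    S j = List.map (insert zero j) (permutations n)

    F : Permutation′ (suc n) → Carrier
    F q = [ q ≟ₚ p ] * f q

    split : ∀ j q → [ insert zero j q ≟ₚ p ] ≈
            [ j Fin.≟ p ⟨$⟩ʳ zero ] * [ q ≟ₚ remove zero p ]
    split j q = trans
      ([]-cong (insert zero j q ≟ₚ p) ((j Fin.≟ p ⟨$⟩ʳ zero) ×-dec (q ≟ₚ remove zero p))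
        (insert-≈⇒ j q p) (insert-≈⇐ j q p))
      ([]-× (j Fin.≟ p ⟨$⟩ʳ zero) (q ≟ₚ remove zero p))

    step : ∀ j → ∑ (S j) F ≈
                 [ j Fin.≟ p ⟨$⟩ʳ zero ] * f (insert zero j (remove zero p))
    step j = begin
      ∑ (S j) F
        ≈⟨ ∑-map (insert zero j) (permutations n) F ⟩
      ∑[ q ∈ permutations n ] ([ insert zero j q ≟ₚ p ] * f (insert zero j q))
        ≈⟨ ∑-cong (permutations n) (λ q → trans (*-congʳ {f (insert zero j q)} (split j q)) (*-assoc _ _ _)) ⟩
      ∑[ q ∈ permutations n ]
        ([ j Fin.≟ p ⟨$⟩ʳ zero ] * ([ q ≟ₚ remove zero p ] * f (insert zero j q)))
        ≈⟨ *-distribˡ-sum [ j Fin.≟ p ⟨$⟩ʳ zero ]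
             (λ i → [ lookup (permutations n) i ≟ₚ remove zero p ]
                    * f (insert zero j (lookup (permutations n) i))) ⟨
      [ j Fin.≟ p ⟨$⟩ʳ zero ] *
        (∑[ q ∈ permutations n ] ([ q ≟ₚ remove zero p ] * f (insert zero j q)))
        ≈⟨ *-congˡ (∑-sift (remove zero p) (f ∘ insert zero j)
             (λ q r q≈r → resp (insert zero j q) (insert zero j r) (insert-cong j q r q≈r))) ⟩
      [ j Fin.≟ p ⟨$⟩ʳ zero ] * f (insert zero j (remove zero p)) ∎

  ∘′-cancel : ∀ {n} (p q r : Permutation′ n) → q ≈ₚ p ∘′ r → r ≈ₚ flip p ∘′ q
  ∘′-cancel p q r eq i =
    ≡.trans (≡.sym (Perm.inverseˡ p)) (≡.cong (flip p ⟨$⟩ʳ_) (≡.sym (eq i)))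

  ∘′-uncancel : ∀ {n} (p q r : Permutation′ n) → r ≈ₚ flip p ∘′ q → q ≈ₚ p ∘′ r
  ∘′-uncancel p q r eq i =
    ≡.trans (≡.sym (Perm.inverseʳ p)) (≡.cong (p ⟨$⟩ʳ_) (≡.sym (eq i)))

  ∑-translate : ∀ {n} (p : Permutation′ n) (f : Permutation′ n → Carrier) → Respects f →
                ∑[ q ∈ permutations n ] f (p ∘′ q) ≈ ∑ (permutations n) f
  ∑-translate {n} p f resp = begin
    ∑[ q ∈ S ] f (p ∘′ q)
      ≈⟨ ∑-cong S (λ q → ∑-sift (p ∘′ q) f resp) ⟨
    ∑[ q ∈ S ] ∑[ r ∈ S ] ([ r ≟ₚ p ∘′ q ] * f r)
      ≈⟨ ∑-comm {length S} {length S}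
           (λ i j → [ lookup S j ≟ₚ p ∘′ lookup S i ] * f (lookup S j)) ⟩
    ∑[ r ∈ S ] ∑[ q ∈ S ] ([ r ≟ₚ p ∘′ q ] * f r)
      ≈⟨ ∑-cong S (λ r → ∑-cong S (λ q → *-congʳ {f r} ([]-cong (r ≟ₚ p ∘′ q) (q ≟ₚ flip p ∘′ r)
           (∘′-cancel p r q) (∘′-uncancel p r q)))) ⟩
    ∑[ r ∈ S ] ∑[ q ∈ S ] ([ q ≟ₚ flip p ∘′ r ] * f r)
      ≈⟨ ∑-cong S (λ r → ∑-sift (flip p ∘′ r) (λ _ → f r) (λ _ _ _ → refl)) ⟩
    ∑ S f ∎
    where S = permutations n

  flip-cong : ∀ {n} (p q : Permutation′ n) → p ≈ₚ q → flip p ≈ₚ flip q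
  flip-cong p q p≈q i = ≡.trans
    (≡.cong (flip p ⟨$⟩ʳ_)
      (≡.trans (≡.sym (Perm.inverseʳ q)) (≡.sym (p≈q (q Perm.⟨$⟩ˡ i)))))
    (Perm.inverseˡ p)

  record Element (n : ℕ) : Set (c ⊔ ℓ₁) where
    field
      coeff : Permutation′ n → Carrier
      resp  : Respects coeff

  open Element public

  infix  4 _≈ᴳ_
  infixl 6 _+ᴳ_
  infixl 7 _*ᴳ_

  _≈ᴳ_ : ∀ {n} → Rel (Element n) ℓ₁
  a ≈ᴳ b = ∀ p → coeff a p ≈ coeff b p

  _+ᴳ_ : ∀ {n} → Element n → Element n → Element n
  coeff (a +ᴳ b) p      = coeff a p + coeff b p
  resp  (a +ᴳ b) p q eq = +-cong (resp a p q eq) (resp b p q eq)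

  -ᴳ_ : ∀ {n} → Element n → Element n
  coeff (-ᴳ a) p      = - coeff a p
  resp  (-ᴳ a) p q eq = -‿cong (resp a p q eq)

  0ᴳ : ∀ {n} → Element n
  coeff 0ᴳ p     = 0#
  resp  0ᴳ _ _ _ = refl

  δ : ∀ {n} → Permutation′ n → Element n
  coeff (δ p) q = [ q ≟ₚ p ]
  resp  (δ p) q r q≈r = []-cong (q ≟ₚ p) (r ≟ₚ p)
    (λ q≈p i → ≡.trans (≡.sym (q≈r i)) (q≈p i))
    (λ r≈p i → ≡.trans (q≈r i) (r≈p i))

  -- (∑ₚ a(p) p)(∑_q b(q) q) has coefficient ∑ₚ a(p) b(p⁻¹r) at r.
  _*ᴳ_ : ∀ {n} → Element n → Element n → Element n
  coeff (_*ᴳ_ {n} a b) r = ∑[ p ∈ permutations n ] (coeff a p * coeff b (flip p ∘′ r))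
  resp  (_*ᴳ_ {n} a b) q r q≈r = ∑-cong (permutations n)
    (λ p → *-congˡ {coeff a p} (resp b (flip p ∘′ q) (flip p ∘′ r) (λ i → ≡.cong (flip p ⟨$⟩ʳ_) (q≈r i))))

  *ᴳ-assoc : ∀ {n} (a b d : Element n) → (a *ᴳ b) *ᴳ d ≈ᴳ a *ᴳ (b *ᴳ d)
  *ᴳ-assoc {n} a b d r = begin
    ∑[ q ∈ S ] ((∑[ p ∈ S ] (coeff a p * coeff b (flip p ∘′ q))) * coeff d (flip q ∘′ r))
      ≈⟨ ∑-cong S (λ q → trans
           (*-distribʳ-sum (coeff d (flip q ∘′ r))
             (λ i → coeff a (lookup S i) * coeff b (flip (lookup S i) ∘′ q)))
           (∑-cong S (λ p → *-assoc (coeff a p) (coeff b (flip p ∘′ q)) (coeff d (flip q ∘′ r))))) ⟩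
    ∑[ q ∈ S ] ∑[ p ∈ S ] (coeff a p * (coeff b (flip p ∘′ q) * coeff d (flip q ∘′ r)))
      ≈⟨ ∑-comm {length S} {length S} (λ i j → coeff a (lookup S j) *
           (coeff b (flip (lookup S j) ∘′ lookup S i) * coeff d (flip (lookup S i) ∘′ r))) ⟩
    ∑[ p ∈ S ] ∑[ q ∈ S ] (coeff a p * (coeff b (flip p ∘′ q) * coeff d (flip q ∘′ r)))
      ≈⟨ ∑-cong S (λ p → *-distribˡ-sum (coeff a p)
           (λ i → coeff b (flip p ∘′ lookup S i) * coeff d (flip (lookup S i) ∘′ r))) ⟨
    ∑[ p ∈ S ] (coeff a p * (∑[ q ∈ S ] (coeff b (flip p ∘′ q) * coeff d (flip q ∘′ r))))
      ≈⟨ ∑-cong S (λ p → *-congˡ {coeff a p} (inner p)) ⟩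
    ∑[ p ∈ S ] (coeff a p * coeff (b *ᴳ d) (flip p ∘′ r)) ∎
    where
    S = permutations n

    inner : ∀ p → ∑[ q ∈ S ] (coeff b (flip p ∘′ q) * coeff d (flip q ∘′ r)) ≈
                  coeff (b *ᴳ d) (flip p ∘′ r)
    inner p = begin
      ∑[ q ∈ S ] (coeff b (flip p ∘′ q) * coeff d (flip q ∘′ r))
        ≈⟨ ∑-cong S (λ q → *-congˡ {coeff b (flip p ∘′ q)} (resp d
             (flip q ∘′ r) (flip (flip p ∘′ q) ∘′ (flip p ∘′ r))
             (λ i → ≡.cong (flip q ⟨$⟩ʳ_) (≡.sym (Perm.inverseʳ p))))) ⟩
      ∑[ q ∈ S ] (coeff b (flip p ∘′ q) * coeff d (flip (flip p ∘′ q) ∘′ (flip p ∘′ r)))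
        ≈⟨ ∑-translate (flip p) (λ q → coeff b q * coeff d (flip q ∘′ (flip p ∘′ r)))
             (λ q q′ q≈q′ → *-cong (resp b q q′ q≈q′)
               (resp d (flip q ∘′ (flip p ∘′ r)) (flip q′ ∘′ (flip p ∘′ r))
                 (λ i → flip-cong q q′ q≈q′ _))) ⟩
      coeff (b *ᴳ d) (flip p ∘′ r) ∎

  *ᴳ-identityˡ : ∀ {n} (a : Element n) → δ idₚ *ᴳ a ≈ᴳ a
  *ᴳ-identityˡ {n} a r = ∑-sift {n} idₚ (λ p → coeff a (flip p ∘′ r))
    (λ p q p≈q → resp a (flip p ∘′ r) (flip q ∘′ r) (λ i → flip-cong p q p≈q _))

  *ᴳ-identityʳ : ∀ {n} (a : Element n) → a *ᴳ δ idₚ ≈ᴳ a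
  *ᴳ-identityʳ {n} a r = begin
    ∑[ p ∈ S ] (coeff a p * [ flip p ∘′ r ≟ₚ idₚ ])
      ≈⟨ ∑-cong S (λ p → trans (*-comm _ _) (*-congʳ {coeff a p}
           ([]-cong (flip p ∘′ r ≟ₚ idₚ) (p ≟ₚ r)
             (λ eq i → ≡.sym (∘′-uncancel p r idₚ (λ j → ≡.sym (eq j)) i))
             (λ eq i → ≡.sym (∘′-cancel p r idₚ (λ j → ≡.sym (eq j)) i))))) ⟩
    ∑[ p ∈ S ] ([ p ≟ₚ r ] * coeff a p)  ≈⟨ ∑-sift r (coeff a) (resp a) ⟩
    coeff a r                            ∎
    where S = permutations n

  groupRing : ℕ → Ring (c ⊔ ℓ₁) ℓ₁
  groupRing n = record
    { Carrier = Element n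
    ; _≈_ = _≈ᴳ_
    ; _+_ = _+ᴳ_
    ; _*_ = _*ᴳ_
    ; -_  = -ᴳ_
    ; 0#  = 0ᴳ
    ; 1#  = δ idₚ
    ; isRing = record
      { +-isAbelianGroup = record
        { isGroup = record
          { isMonoid = record
            { isSemigroup = record
              { isMagma = record
                { isEquivalence = record
                  { refl  = λ p → refl
                  ; sym   = λ eq p → sym (eq p)
                  ; trans = λ eq eq′ p → trans (eq p) (eq′ p)
                  }
                ; ∙-cong = λ eq eq′ p → +-cong (eq p) (eq′ p)
                }
              ; assoc = λ a b d p → +-assoc _ _ _
              }
            ; identity = (λ a p → +-identityˡ _) , (λ a p → +-identityʳ _)
            }
          ; inverse = (λ a p → -‿inverseˡ _) , (λ a p → -‿inverseʳ _)
          ; ⁻¹-cong = λ eq p → -‿cong (eq p)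
          }
        ; comm = λ a b p → +-comm _ _
        }
      ; *-cong     = λ eq eq′ r → ∑-cong (permutations n) (λ p → *-cong (eq p) (eq′ (flip p ∘′ r)))
      ; *-assoc    = *ᴳ-assoc
      ; *-identity = *ᴳ-identityˡ , *ᴳ-identityʳ
      ; distrib    =
          (λ a b d r → trans (∑-cong (permutations n) (λ p → distribˡ (coeff a p) (coeff b (flip p ∘′ r)) (coeff d (flip p ∘′ r))))
            (∑-distrib-+
              (λ i → let p = lookup (permutations n) i in coeff a p * coeff b (flip p ∘′ r))
              (λ i → let p = lookup (permutations n) i in coeff a p * coeff d (flip p ∘′ r))))
        , (λ a b d r → trans (∑-cong (permutations n) (λ p → distribʳ (coeff a (flip p ∘′ r)) (coeff b p) (coeff d p)))
            (∑-distrib-+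
              (λ i → let p = lookup (permutations n) i in coeff b p * coeff a (flip p ∘′ r))
              (λ i → let p = lookup (permutations n) i in coeff d p * coeff a (flip p ∘′ r))))
      }
    }

  infix 9 _⋆

  _⋆ : ∀ {n} → Element n → Element n
  coeff (a ⋆) p = coeff a (flip p)
  resp  (a ⋆) p q p≈q = resp a (flip p) (flip q) (flip-cong p q p≈q)

  sign : ∀ {n} → Permutation′ n → Carrier
  sign p = (- 1#) ^ inversions p

  youngSymmetrizer : ∀ {n} {μ : Partition n} → YoungTableau μ → Element n
  coeff (youngSymmetrizer t) r =
    ∑[ p ∈ rowGroup t ] ∑[ q ∈ columnGroup t ] (sign q * coeff (δ (p ∘′ q)) r)
  resp  (youngSymmetrizer t) r s r≈s =
    ∑-cong (rowGroup t) (λ p → ∑-cong (columnGroup t) (λ q →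
      *-congˡ {sign q} (resp (δ (p ∘′ q)) r s r≈s)))

  IdealOf : ℕ → ∀ ℓ₃ → Set (c ⊔ ℓ₁ ⊔ Lv.suc ℓ₃)
  IdealOf n = RightIdeal (groupRing n)

  -- Nonzero is taken in the positive sense of the apartness; classically
  -- it says that the ideal contains an element other than 0.
  IsNonzero : ∀ {n} → IdealOf n ℓ₃ → Set (c ⊔ ℓ₁ ⊔ ℓ₂ ⊔ ℓ₃)
  IsNonzero I = ∃[ a ] RightIdeal.Member I a × ∃[ p ] coeff a p # 0#

  infix 4 _⊆_

  _⊆_ : ∀ {n} → IdealOf n ℓ₃ → IdealOf n ℓ₃ → Set (c ⊔ ℓ₁ ⊔ ℓ₃)
  I ⊆ J = ∀ a → RightIdeal.Member I a → RightIdeal.Member J a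

  IsMinimal : ∀ {n} → IdealOf n ℓ₃ → Set (c ⊔ ℓ₁ ⊔ ℓ₂ ⊔ Lv.suc ℓ₃)
  IsMinimal {ℓ₃} {n} I =
    IsNonzero I × (∀ (J : IdealOf n ℓ₃) → IsNonzero J → J ⊆ I → I ⊆ J)

  HasClass : ∀ {n} → IdealOf n ℓ₃ → Partition n → Set (c ⊔ ℓ₁ ⊔ ℓ₃)
  HasClass {n = n} I μ = Σ (YoungTableau μ) λ t → I ≅ principal (groupRing n) (youngSymmetrizer t)

module Tensors (K : HeytingField c ℓ₁ ℓ₂) (V : Module (commutativeRing K) m ℓm) where
  open CommutativeRing (commutativeRing K) hiding (zero)
  open GroupRing K
  open Module V using (Carrierᴹ; _≈ᴹ_; _+ᴹ_; _*ₗ_; 0ᴹ; ≈ᴹ-refl; ≈ᴹ-reflexive; +ᴹ-commutativeMonoid)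
  open SemiringSum semiring using (∑-distrib-+; *-distribˡ-sum)
  open SetoidReasoning setoid

  record FiniteDimensional : Set (c ⊔ ℓ₁ ⊔ m ⊔ ℓm) where
    open CMSum +ᴹ-commutativeMonoid using () renaming (sum to sumᴹ)
    field
      dimension   : ℕ
      basis       : Vector Carrierᴹ dimension
      spanning    : ∀ v → Σ (Vector Carrier dimension) λ a → v ≈ᴹ sumᴹ (λ i → a i *ₗ basis i)
      independent : ∀ (a : Vector Carrier dimension) →
                    sumᴹ (λ i → a i *ₗ basis i) ≈ᴹ 0ᴹ → ∀ i → a i ≈ 0#

  infixl 8 _[_]≔_

  _[_]≔_ : ∀ {r} → Vector Carrierᴹ r → Fin r → Carrierᴹ → Vector Carrierᴹ r
  v [ i ]≔ x = updateAt v i (const x)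

  record Tensor (r : ℕ) : Set (c ⊔ ℓ₁ ⊔ m ⊔ ℓm) where
    field
      ⟦_⟧      : Vector Carrierᴹ r → Carrier
      ⟦⟧-cong  : ∀ {v w} → (∀ i → v i ≈ᴹ w i) → ⟦_⟧ v ≈ ⟦_⟧ w
      +-linear : ∀ v i x y → ⟦_⟧ (v [ i ]≔ (x +ᴹ y)) ≈ ⟦_⟧ (v [ i ]≔ x) + ⟦_⟧ (v [ i ]≔ y)
      *-linear : ∀ v i k x → ⟦_⟧ (v [ i ]≔ (k *ₗ x)) ≈ k * ⟦_⟧ (v [ i ]≔ x)

  open Tensor public

  infix 4 _≈ᵀ_

  _≈ᵀ_ : ∀ {r} → Rel (Tensor r) (ℓ₁ ⊔ m)
  T ≈ᵀ S = ∀ v → ⟦ T ⟧ v ≈ ⟦ S ⟧ v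

  0ᵀ : ∀ {r} → Tensor r
  0ᵀ = record
    { ⟦_⟧      = const 0#
    ; ⟦⟧-cong  = λ _ → refl
    ; +-linear = λ _ _ _ _ → sym (+-identityˡ 0#)
    ; *-linear = λ _ _ k _ → sym (zeroʳ k)
    }

  update-∘ : ∀ {r s} (f : Fin s → Fin r) (j : Fin s) → (∀ k → f k ≡ f j → k ≡ j) →
             ∀ v x k → (v [ f j ]≔ x) (f k) ≡ ((v ∘ f) [ j ]≔ x) k
  update-∘ f j inj v x k with k Fin.≟ j
  ... | yes ≡.refl = ≡.trans (updateAt-updates (f j) v) (≡.sym (updateAt-updates j (v ∘ f)))
  ... | no k≢j     = ≡.trans (updateAt-minimal (f k) (f j) v (k≢j ∘ inj k))
                             (≡.sym (updateAt-minimal k j (v ∘ f) k≢j))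

  update-miss : ∀ {r s} (f : Fin s → Fin r) i → (∀ k → f k ≢ i) →
                ∀ v x k → (v [ i ]≔ x) (f k) ≡ v (f k)
  update-miss f i miss v x k = updateAt-minimal (f k) i v (miss k)

  module _ {r} (T : Tensor r) where

    ⟦⟧-cong-≡ : ∀ {v w} → (∀ i → v i ≡ w i) → ⟦ T ⟧ v ≈ ⟦ T ⟧ w
    ⟦⟧-cong-≡ eq = ⟦⟧-cong T (λ i → ≈ᴹ-reflexive (eq i))

    ⟦⟧-permuted : ∀ (p : Permutation′ r) v i x →
                  ⟦ T ⟧ ((v [ i ]≔ x) ∘ (p ⟨$⟩ʳ_)) ≈
                  ⟦ T ⟧ ((v ∘ (p ⟨$⟩ʳ_)) [ flip p ⟨$⟩ʳ i ]≔ x)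
    ⟦⟧-permuted p v i x = ⟦⟧-cong-≡ λ k → ≡.trans
      (≡.cong (λ j → (v [ j ]≔ x) (p ⟨$⟩ʳ k)) (≡.sym (Perm.inverseʳ p)))
      (update-∘ (p ⟨$⟩ʳ_) (flip p ⟨$⟩ʳ i) (λ k eq → ≡.trans (≡.sym (Perm.inverseˡ p))
        (≡.trans (≡.cong (flip p ⟨$⟩ʳ_) eq) (Perm.inverseˡ p))) v x k)

  *-swap : ∀ x y z → x * (y * z) ≈ y * (x * z)
  *-swap x y z = begin
    x * (y * z)  ≈⟨ *-assoc x y z ⟨
    (x * y) * z  ≈⟨ *-congʳ (*-comm x y) ⟩
    (y * x) * z  ≈⟨ *-assoc y x z ⟩
    y * (x * z)  ∎

  infixr 7 _·_

  _·_ : ∀ {r} → Element r → Tensor r → Tensor r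
  _·_ {r} a T = record
    { ⟦_⟧      = λ v → ∑[ p ∈ S ] (coeff a p * ⟦ T ⟧ (λ i → v (p ⟨$⟩ʳ i)))
    ; ⟦⟧-cong  = λ v≈w → ∑-cong S (λ p → *-congˡ {coeff a p} (⟦⟧-cong T (λ i → v≈w (p ⟨$⟩ʳ i))))
    ; +-linear = λ v i x y → trans
        (∑-cong S (λ p → trans
          (*-congˡ {coeff a p} (trans (⟦⟧-permuted T p v i (x +ᴹ y))
            (trans (+-linear T _ _ x y)
              (sym (+-cong (⟦⟧-permuted T p v i x) (⟦⟧-permuted T p v i y))))))
          (distribˡ (coeff a p) _ _)))
        (∑-distrib-+
          (λ j → coeff a (lookup S j) * ⟦ T ⟧ ((v [ i ]≔ x) ∘ (lookup S j ⟨$⟩ʳ_)))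
          (λ j → coeff a (lookup S j) * ⟦ T ⟧ ((v [ i ]≔ y) ∘ (lookup S j ⟨$⟩ʳ_))))
    ; *-linear = λ v i k x → trans
        (∑-cong S (λ p → trans
          (*-congˡ {coeff a p} (trans (⟦⟧-permuted T p v i (k *ₗ x))
            (trans (*-linear T _ _ k x) (*-congˡ (sym (⟦⟧-permuted T p v i x))))))
          (*-swap (coeff a p) k _)))
        (sym (*-distribˡ-sum k
          (λ j → coeff a (lookup S j) * ⟦ T ⟧ ((v [ i ]≔ x) ∘ (lookup S j ⟨$⟩ʳ_)))))
    }
    where
    S = permutations r

  infixr 8 _⊗_

  _⊗_ : ∀ {r s} → Tensor r → Tensor s → Tensor (r ℕ.+ s)
  _⊗_ {r} {s} T U = record
    { ⟦_⟧      = λ v → ⟦ T ⟧ (λ i → v (i ↑ˡ s)) * ⟦ U ⟧ (λ j → v (r ↑ʳ j))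
    ; ⟦⟧-cong  = λ v≈w → *-cong (⟦⟧-cong T (λ i → v≈w (i ↑ˡ s))) (⟦⟧-cong U (λ j → v≈w (r ↑ʳ j)))
    ; +-linear = λ v i x y → +-lin v i x y (splitAt r i) (Fin.join-splitAt r s i)
    ; *-linear = λ v i k x → *-lin v i k x (splitAt r i) (Fin.join-splitAt r s i)
    }
    where
    left-hit : ∀ v i x → ⟦ T ⟧ ((v [ i ↑ˡ s ]≔ x) ∘ (_↑ˡ s)) ≈ ⟦ T ⟧ ((v ∘ (_↑ˡ s)) [ i ]≔ x)
    left-hit v i x = ⟦⟧-cong-≡ T (update-∘ (_↑ˡ s) i (λ k → Fin.↑ˡ-injective s k i) v x)

    right-hit : ∀ v j x → ⟦ U ⟧ ((v [ r ↑ʳ j ]≔ x) ∘ (r ↑ʳ_)) ≈ ⟦ U ⟧ ((v ∘ (r ↑ʳ_)) [ j ]≔ x)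
    right-hit v j x = ⟦⟧-cong-≡ U (update-∘ (r ↑ʳ_) j (λ k → Fin.↑ʳ-injective r k j) v x)

    ↑ˡ≢↑ʳ : ∀ (i : Fin r) (j : Fin s) → i ↑ˡ s ≢ r ↑ʳ j
    ↑ˡ≢↑ʳ i j eq with ≡.trans (≡.sym (Fin.splitAt-↑ˡ r i s))
                       (≡.trans (≡.cong (splitAt r) eq) (Fin.splitAt-↑ʳ r s j))
    ... | ()

    left-miss : ∀ v j x → ⟦ T ⟧ ((v [ r ↑ʳ j ]≔ x) ∘ (_↑ˡ s)) ≈ ⟦ T ⟧ (v ∘ (_↑ˡ s))
    left-miss v j x = ⟦⟧-cong-≡ T (update-miss (_↑ˡ s) (r ↑ʳ j) (λ k → ↑ˡ≢↑ʳ k j) v x)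

    right-miss : ∀ v i x → ⟦ U ⟧ ((v [ i ↑ˡ s ]≔ x) ∘ (r ↑ʳ_)) ≈ ⟦ U ⟧ (v ∘ (r ↑ʳ_))
    right-miss v i x =
      ⟦⟧-cong-≡ U (update-miss (r ↑ʳ_) (i ↑ˡ s) (λ k eq → ↑ˡ≢↑ʳ i k (≡.sym eq)) v x)

    value : Vector Carrierᴹ (r ℕ.+ s) → Carrier
    value v = ⟦ T ⟧ (λ i → v (i ↑ˡ s)) * ⟦ U ⟧ (λ j → v (r ↑ʳ j))

    value-left : ∀ v i x →
      value (v [ i ↑ˡ s ]≔ x) ≈ ⟦ T ⟧ ((v ∘ (_↑ˡ s)) [ i ]≔ x) * ⟦ U ⟧ (v ∘ (r ↑ʳ_))
    value-left v i x = *-cong (left-hit v i x) (right-miss v i x)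

    value-right : ∀ v j x →
      value (v [ r ↑ʳ j ]≔ x) ≈ ⟦ T ⟧ (v ∘ (_↑ˡ s)) * ⟦ U ⟧ ((v ∘ (r ↑ʳ_)) [ j ]≔ x)
    value-right v j x = *-cong (left-miss v j x) (right-hit v j x)

    +-lin : ∀ v i x y (k : Fin r ⊎ Fin s) → join r s k ≡ i →
            value (v [ i ]≔ (x +ᴹ y)) ≈ value (v [ i ]≔ x) + value (v [ i ]≔ y)
    +-lin v _ x y (inj₁ i) ≡.refl = trans (value-left v i (x +ᴹ y))
      (trans (*-congʳ (+-linear T (v ∘ (_↑ˡ s)) i x y))
      (trans (distribʳ _ _ _)
      (sym (+-cong (value-left v i x) (value-left v i y)))))
    +-lin v _ x y (inj₂ j) ≡.refl = trans (value-right v j (x +ᴹ y))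
      (trans (*-congˡ (+-linear U (v ∘ (r ↑ʳ_)) j x y))
      (trans (distribˡ _ _ _)
      (sym (+-cong (value-right v j x) (value-right v j y)))))

    *-lin : ∀ v i a x (k : Fin r ⊎ Fin s) → join r s k ≡ i →
            value (v [ i ]≔ (a *ₗ x)) ≈ a * value (v [ i ]≔ x)
    *-lin v _ a x (inj₁ i) ≡.refl = trans (value-left v i (a *ₗ x))
      (trans (*-congʳ (*-linear T (v ∘ (_↑ˡ s)) i a x))
      (trans (*-assoc _ _ _) (*-congˡ (sym (value-left v i x)))))
    *-lin v _ a x (inj₂ j) ≡.refl = trans (value-right v j (a *ₗ x))
      (trans (*-congˡ (*-linear U (v ∘ (r ↑ʳ_)) j a x))
      (trans (*-swap _ a _) (*-congˡ (sym (value-right v j x)))))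

  SymmetryClass : ∀ {r} → IdealOf r ℓ₃ → Tensor r → Set (c ⊔ ℓ₁ ⊔ m ⊔ ℓm ⊔ ℓ₃)
  SymmetryClass {r = r} I T =
    ∃[ a ] RightIdeal.Member I a × Σ (Tensor r) λ T₀ → T ≈ᵀ a · T₀

  record IsCovariantDerivativeCurvatureTensor (R : Tensor 5) : Set (ℓ₁ ⊔ m) where
    private
      R⟨_,_,_,_,_⟩ : (w x y z u : Carrierᴹ) → Carrier
      R⟨ w , x , y , z , u ⟩ = ⟦ R ⟧ (w ∷ᵥ x ∷ᵥ y ∷ᵥ z ∷ᵥ u ∷ᵥ []ᵥ)
    field
      antisymmetry  : ∀ u w x y z → R⟨ w , x , y , z , u ⟩ ≈ - R⟨ w , x , z , y , u ⟩
      pairSymmetry  : ∀ u w x y z → R⟨ w , x , y , z , u ⟩ ≈ R⟨ y , z , w , x , u ⟩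
      firstBianchi  : ∀ u w x y z →
        R⟨ w , x , y , z , u ⟩ + R⟨ w , y , z , x , u ⟩ + R⟨ w , z , x , y , u ⟩ ≈ 0#
      secondBianchi : ∀ u w x y z →
        R⟨ w , x , y , z , u ⟩ + R⟨ w , x , z , u , y ⟩ + R⟨ w , x , u , y , z ⟩ ≈ 0#

{-# OPTIONS --safe #-}

-- Right multiplication by r - χ(r) annihilates y_t K[S_n] when t has a single row (χ = 1) or a
-- single column (χ = sign), hence also every ideal isomorphic to it; so tensors of class (n) are
-- symmetric and those of class (1ⁿ) are alternating.  Outside the three admissible pairs, either U
-- is alternating, and then two of its arguments lie in one row of t′, so that the row symmetrizer
-- kills the product; or T is alternating and U is symmetric.  In that case each term of the
-- symmetrized product is determined by the pair (i , j) of arguments of T.  Antisymmetrizing over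
-- the columns kills it when U receives both entries of a column, and the remaining pairs (0 , 3)
-- and (2 , 1) cancel.

module Submission where

open import Defs
open import Algebra.Apartness.Bundles using (HeytingField)
open import Algebra.Bundles using (CommutativeRing; Semiring)
import Algebra.Definitions.RawSemiring as RawSemiringDefs
open import Algebra.Module.Bundles using (Module)
import Algebra.Module.Morphism.Structures as ModuleMorphisms
import Algebra.Properties.CommutativeSemigroup as CommutativeSemigroupProperties
import Algebra.Properties.Ring as RingProperties
import Algebra.Properties.Semiring.Exp as Exponentiation
import Algebra.Properties.Semiring.Sum as SemiringSum
open import Data.Fin.Base using (Fin; zero; suc; toℕ; punchIn; _<_; _↑ˡ_; _↑ʳ_)
open import Data.Fin.Patterns using (0F; 1F; 2F; 3F; 4F)
open import Data.Fin.Permutation as Perm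
  using (Permutation′; _⟨$⟩ʳ_; flip; insert; remove; transpose)
  renaming (_≈_ to _≈ₚ_; id to idₚ)
import Data.Fin.Properties as Fin
open import Data.List.Base as List using (List; []; _∷_; length; lookup; filter; allFin; cartesianProduct)
import Data.List.Properties as List
open import Data.List.Relation.Unary.All as All using (All; []; _∷_)
open import Data.List.Relation.Unary.Any as Any using (Any; here)
import Data.List.Relation.Unary.Any.Properties as Any
open import Data.List.Relation.Unary.Linked using (_∷_)
open import Data.Nat.Base as ℕ using (ℕ; zero; suc; parity; s≤s)
import Data.Nat.Properties as ℕ
open import Data.Parity.Base using (Parity; 0ℙ; 1ℙ)
import Data.Parity.Properties as ℙ
open import Data.Product.Base using (_×_; _,_; proj₁; proj₂)
open import Data.Sum.Base using (_⊎_; inj₁; inj₂; [_,_]′)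
open import Data.Vec.Base as Vec using (Vec; []; _∷_)
import Data.Vec.Properties as Vec
open import Data.Vec.Functional using (Vector) renaming ([] to []ᵥ; _∷_ to _∷ᵥ_)
open import Function.Base using (_∘_; const)
open import Function.Bundles using (Inverse)
open import Level using (Level)
open import Relation.Binary.Definitions using (tri<; tri≈; tri>)
open import Relation.Binary.PropositionalEquality as ≡ using (_≡_; _≢_)
import Relation.Binary.Reasoning.Setoid as SetoidReasoning
open import Relation.Nullary.Decidable
  using (Dec; yes; no; from-yes; _×-dec_; _⊎-dec_; ¬?; decidable-stable)
open import Relation.Nullary.Negation using (¬_; contradiction)
open import Relation.Unary using (Decidable)

-- The tableau stays a variable `t` throughout the tensor calculation, because comparing terms for a
-- concrete tableau would unfold sums over all 120 permutations. Four facts stand in for its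
-- filling: the tables of its row and column groups, and that the swaps of 0 with 2 and of 2 with 4
-- preserve rows. Each is a separate finite evaluation in which the field does not occur. K is
-- abstract as well, so equations in it cannot be decided by computation: signs are compared as
-- parities of inversion numbers, and the final cancellations are ring identities. Permutations are
-- compared only by `_≈ₚ_`, so a sum over `permutations` is reindexed not by rearranging the list
-- but by inserting an indicator function and exchanging two sums.

-- Parity of permutations

permutations-complete : ∀ {n} (p : Permutation′ n) → Any (_≈ₚ p) (permutations n)
permutations-complete {zero}  p = here λ ()
permutations-complete {suc n} p =
  Any.concatMap⁺ (λ j → List.map (insert zero j) (permutations n))
    (Any.tabulate⁺ {f = λ j → j} (p ⟨$⟩ʳ zero) (Any.map⁺ (Any.map
      (λ {q} → insert-zero-≈ q)
      (permutations-complete (remove zero p)))))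
  where
  insert-zero-≈ : ∀ q → q ≈ₚ remove zero p → insert zero (p ⟨$⟩ʳ zero) q ≈ₚ p
  insert-zero-≈ q q≈ zero    = ≡.refl
  insert-zero-≈ q q≈ (suc k) =
    ≡.trans (≡.cong (punchIn (p ⟨$⟩ʳ zero)) (q≈ k)) (≡.sym (Perm.punchIn-permute p zero k))

inversions-cong : ∀ {n} (p q : Permutation′ n) → p ≈ₚ q → inversions p ≡ inversions q
inversions-cong {n} p q p≈q = ≡.cong length (List.filter-≐ _ _
  ( (λ { {i , j} (i<j , pj<pi) → i<j , ≡.subst₂ _<_ (p≈q j) (p≈q i) pj<pi })
  , (λ { {i , j} (i<j , qj<qi) → i<j , ≡.subst₂ _<_ (≡.sym (p≈q j)) (≡.sym (p≈q i)) qj<qi }))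
  (cartesianProduct (allFin n) (allFin n)))

-- Multiplicativity of `sign`, stated for parities instead of elements of K so that evaluation can
-- decide it.
ParityAdditive : ∀ {n} → Permutation′ n → Permutation′ n → Set
ParityAdditive p q = parity (inversions (p ∘′ q)) ≡ parity (inversions p ℕ.+ inversions q)

parityAdditive? : ∀ n →
  Dec (All (λ p → All (λ q → ParityAdditive p q) (permutations n)) (permutations n))
parityAdditive? n = All.all? (λ p → All.all? (λ q → _ ℙ.≟ _) (permutations n)) (permutations n)

-- A check over the listed representatives extends to all permutations: each one is `_≈ₚ_` to a
-- listed one, and `inversions` respects this relation.
parityAdditive : ∀ {n} → All (λ p → All (λ q → ParityAdditive p q) (permutations n)) (permutations n) →
                 ∀ (p q : Permutation′ n) → ParityAdditive p q
parityAdditive all p q = begin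
  parity (inversions (p ∘′ q))
    ≡⟨ ≡.cong parity (inversions-cong (p′ ∘′ q′) (p ∘′ q)
         (λ i → ≡.trans (p′≈p (q′ ⟨$⟩ʳ i)) (≡.cong (p ⟨$⟩ʳ_) (q′≈q i)))) ⟨
  parity (inversions (p′ ∘′ q′))
    ≡⟨ proj₁ (All.lookupAny (proj₁ (All.lookupAny all p∈)) q∈) ⟩
  parity (inversions p′ ℕ.+ inversions q′)
    ≡⟨ ≡.cong parity (≡.cong₂ ℕ._+_ (inversions-cong p′ p p′≈p) (inversions-cong q′ q q′≈q)) ⟩
  parity (inversions p ℕ.+ inversions q)
    ∎
  where
  open ≡.≡-Reasoning
  p∈ = permutations-complete p
  q∈ = permutations-complete q
  p′ = Any.lookup p∈
  q′ = Any.lookup q∈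
  p′≈p = proj₂ (All.lookupAny all p∈)
  q′≈q = proj₂ (All.lookupAny (proj₁ (All.lookupAny all p∈)) q∈)

parityAdditive₂ : ∀ (p q : Permutation′ 2) → ParityAdditive p q
parityAdditive₂ = parityAdditive (from-yes (parityAdditive? 2))

parityAdditive₃ : ∀ (p q : Permutation′ 3) → ParityAdditive p q
parityAdditive₃ = parityAdditive (from-yes (parityAdditive? 3))

-- Partitions of 2 and 3, tableaux with a single row or column

OneRow OneColumn : ∀ {n} → Partition n → Set
OneRow    {n} μ = Partition.parts μ ≡ n ∷ []
OneColumn {n} μ = Partition.parts μ ≡ List.replicate n 1

singleton-Fin : ∀ {k} → k ≡ 1 → (i j : Fin k) → i ≡ j
singleton-Fin ≡.refl 0F 0F = ≡.refl

lookup-replicate : ∀ {A : Set} k (x : A) i → lookup (List.replicate k x) i ≡ x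
lookup-replicate (suc k) x zero    = ≡.refl
lookup-replicate (suc k) x (suc i) = lookup-replicate k x i

module _ {n} {μ : Partition n} (t : YoungTableau μ) where

  open YoungTableau t
  open Partition μ

  cell-injective : ∀ x y → cell x ≡ cell y → x ≡ y
  cell-injective x y eq = ≡.trans (≡.sym (strictlyInverseˡ x)) (≡.trans (≡.cong entry eq) (strictlyInverseˡ y))
    where open Inverse filling using (strictlyInverseˡ)

  oneRow-row : OneRow μ → ∀ x y → row t x ≡ row t y
  oneRow-row eq x y = singleton-Fin (≡.cong length eq) (row t x) (row t y)

  oneRow-column : OneRow μ → ∀ x y → column t x ≡ column t y → x ≡ y
  oneRow-column eq x y = cell-injective x y ∘ same (oneRow-row eq x y)
    where
    same : ∀ {a b : Cell μ} → proj₁ a ≡ proj₁ b → toℕ (proj₂ a) ≡ toℕ (proj₂ b) → a ≡ b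
    same {i , _} ≡.refl j≡k = ≡.cong (i ,_) (Fin.toℕ-injective j≡k)

  oneColumn-parts : OneColumn μ → ∀ i → lookup parts i ≡ 1
  oneColumn-parts eq = ≡.subst (λ xs → ∀ i → lookup xs i ≡ 1) (≡.sym eq) (lookup-replicate n 1)

  oneColumn-row : OneColumn μ → ∀ x y → row t x ≡ row t y → x ≡ y
  oneColumn-row eq x y = cell-injective x y ∘ same
    where
    same : ∀ {a b : Cell μ} → proj₁ a ≡ proj₁ b → a ≡ b
    same {i , j} {_ , k} ≡.refl = ≡.cong (i ,_) (singleton-Fin (oneColumn-parts eq i) j k)

  oneColumn-column : OneColumn μ → ∀ x y → column t x ≡ column t y
  oneColumn-column eq x y = ≡.trans (zeroColumn (cell x)) (≡.sym (zeroColumn (cell y)))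
    where
    zeroColumn : ∀ (a : Cell μ) → toℕ (proj₂ a) ≡ 0
    zeroColumn (i , j) = ℕ.n<1⇒n≡0 (≡.subst (toℕ j ℕ.<_) (oneColumn-parts eq i) (Fin.toℕ<n j))

partition₂-cases : ∀ (μ : Partition 2) → OneRow μ ⊎ OneColumn μ
partition₂-cases record { parts = [] ; sums = () }
partition₂-cases record { parts = 0 ∷ _ ; positive = () ∷ _ }
partition₂-cases record { parts = 1 ∷ [] ; sums = () }
partition₂-cases record { parts = 1 ∷ 0 ∷ _ ; positive = _ ∷ () ∷ _ }
partition₂-cases record { parts = 1 ∷ 1 ∷ [] } = inj₂ ≡.refl
partition₂-cases record { parts = 1 ∷ 1 ∷ 0 ∷ _ ; positive = _ ∷ _ ∷ () ∷ _ }
partition₂-cases record { parts = 1 ∷ 1 ∷ suc _ ∷ _ ; sums = () }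
partition₂-cases record { parts = 1 ∷ suc (suc _) ∷ _ ; sums = () }
partition₂-cases record { parts = 2 ∷ [] } = inj₁ ≡.refl
partition₂-cases record { parts = 2 ∷ 0 ∷ _ ; positive = _ ∷ () ∷ _ }
partition₂-cases record { parts = 2 ∷ suc _ ∷ _ ; sums = () }
partition₂-cases record { parts = suc (suc (suc _)) ∷ _ ; sums = () }

partition₃-cases : ∀ (ν : Partition 3) →
  OneRow ν ⊎ Partition.parts ν ≡ 2 ∷ 1 ∷ [] ⊎ OneColumn ν
partition₃-cases record { parts = [] ; sums = () }
partition₃-cases record { parts = 0 ∷ _ ; positive = () ∷ _ }
partition₃-cases record { parts = 1 ∷ [] ; sums = () }
partition₃-cases record { parts = 1 ∷ 0 ∷ _ ; positive = _ ∷ () ∷ _ }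
partition₃-cases record { parts = 1 ∷ 1 ∷ [] ; sums = () }
partition₃-cases record { parts = 1 ∷ 1 ∷ 0 ∷ _ ; positive = _ ∷ _ ∷ () ∷ _ }
partition₃-cases record { parts = 1 ∷ 1 ∷ 1 ∷ [] } = inj₂ (inj₂ ≡.refl)
partition₃-cases record { parts = 1 ∷ 1 ∷ 1 ∷ 0 ∷ _ ; positive = _ ∷ _ ∷ _ ∷ () ∷ _ }
partition₃-cases record { parts = 1 ∷ 1 ∷ 1 ∷ suc _ ∷ _ ; sums = () }
partition₃-cases record { parts = 1 ∷ 1 ∷ suc (suc _) ∷ _ ; sums = () }
-- The composition 1 + 2 has positive parts and the right sum; only `decreasing` excludes it.
partition₃-cases record { parts = 1 ∷ suc (suc _) ∷ _ ; decreasing = s≤s () ∷ _ }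
partition₃-cases record { parts = 2 ∷ [] ; sums = () }
partition₃-cases record { parts = 2 ∷ 0 ∷ _ ; positive = _ ∷ () ∷ _ }
partition₃-cases record { parts = 2 ∷ 1 ∷ [] } = inj₂ (inj₁ ≡.refl)
partition₃-cases record { parts = 2 ∷ 1 ∷ 0 ∷ _ ; positive = _ ∷ _ ∷ () ∷ _ }
partition₃-cases record { parts = 2 ∷ 1 ∷ suc _ ∷ _ ; sums = () }
partition₃-cases record { parts = 2 ∷ suc (suc _) ∷ _ ; sums = () }
partition₃-cases record { parts = 3 ∷ [] } = inj₁ ≡.refl
partition₃-cases record { parts = 3 ∷ 0 ∷ _ ; positive = _ ∷ () ∷ _ }
partition₃-cases record { parts = 3 ∷ suc _ ∷ _ ; sums = () }
partition₃-cases record { parts = suc (suc (suc (suc _))) ∷ _ ; sums = () }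

-- Makes the second half of the theorem constructive: admissibility follows from the refutation of
-- its negation.
admissiblePair? : ∀ μ ν → Dec (AdmissiblePair μ ν)
admissiblePair? μ ν =
  (parts μ ≟ _ ×-dec parts ν ≟ _) ⊎-dec (parts μ ≟ _ ×-dec parts ν ≟ _)
    ⊎-dec (parts μ ≟ _ ×-dec parts ν ≟ _)
  where
  open Partition
  infix 5 _≟_
  _≟_ = List.≡-dec ℕ._≟_

inadmissible-cases : ∀ μ ν → ¬ AdmissiblePair μ ν → OneColumn ν ⊎ (OneColumn μ × OneRow ν)
inadmissible-cases μ ν ¬adm with partition₂-cases μ | partition₃-cases ν
... | _       | inj₂ (inj₂ ν₁₁₁) = inj₁ ν₁₁₁
... | inj₂ μ₁₁ | inj₁ ν₃          = inj₂ (μ₁₁ , ν₃)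
... | inj₁ μ₂  | inj₁ ν₃          = contradiction (inj₁ (μ₂ , ν₃)) ¬adm
... | inj₁ μ₂  | inj₂ (inj₁ ν₂₁)  = contradiction (inj₂ (inj₁ (μ₂ , ν₂₁))) ¬adm
... | inj₂ μ₁₁ | inj₂ (inj₁ ν₂₁)  = contradiction (inj₂ (inj₂ (μ₁₁ , ν₂₁))) ¬adm

-- Sums over the symmetric group and semi-invariant elements

module GroupRingProperties {c ℓ₁ ℓ₂ : Level} (K : HeytingField c ℓ₁ ℓ₂) where

  open CommutativeRing (commutativeRing K) hiding (zero)
  open GroupRing K
  open RawSemiringDefs (Semiring.rawSemiring semiring) using (_^_)
  open SemiringSum semiring
    using (∑-distrib-+; *-distribˡ-sum; *-distribʳ-sum) renaming (∑-comm to sum-comm)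
  open Exponentiation semiring using (^-homo-*)
  open RingProperties ring
    using (-‿distribʳ-*; -1*x≈-x; -‿involutive; x∙y⁻¹≈ε⇒x≈y; x≈y⇒x∙y⁻¹≈ε)
  open SetoidReasoning setoid

  module _ {a} {A : Set a} where

    ∑-+ : ∀ (xs : List A) f g → ∑ xs (λ x → f x + g x) ≈ ∑ xs f + ∑ xs g
    ∑-+ xs f g = ∑-distrib-+ (f ∘ lookup xs) (g ∘ lookup xs)

    ∑-*ˡ : ∀ (xs : List A) k f → k * ∑ xs f ≈ ∑[ x ∈ xs ] (k * f x)
    ∑-*ˡ xs k f = *-distribˡ-sum k (f ∘ lookup xs)

    ∑-*ʳ : ∀ (xs : List A) k f → ∑ xs f * k ≈ ∑[ x ∈ xs ] (f x * k)
    ∑-*ʳ xs k f = *-distribʳ-sum k (f ∘ lookup xs)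

    ∑-comm : ∀ {b} {B : Set b} (xs : List A) (ys : List B) (f : A → B → Carrier) →
             ∑[ x ∈ xs ] ∑[ y ∈ ys ] f x y ≈ ∑[ y ∈ ys ] ∑[ x ∈ xs ] f x y
    ∑-comm xs ys f = sum-comm {length xs} {length ys} (λ i j → f (lookup xs i) (lookup ys j))

    ∑-filter : ∀ {p} {P : A → Set p} (P? : Decidable P) xs f →
               ∑ (filter P? xs) f ≈ ∑[ x ∈ xs ] ([ P? x ] * f x)
    ∑-filter P? []       f = refl
    ∑-filter P? (x ∷ xs) f with P? x
    ... | yes _ = +-cong (sym (*-identityˡ (f x))) (∑-filter P? xs f)
    ... | no _  = trans (sym (+-identityˡ _)) (+-cong (sym (zeroˡ (f x))) (∑-filter P? xs f))

    ∑-const0 : ∀ (xs : List A) {f : A → Carrier} → (∀ x → f x ≈ 0#) → ∑ xs f ≈ 0#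
    ∑-const0 xs f≈0 = trans (∑-cong xs f≈0) (∑-zero xs)

  []-¬ : ∀ {p} {P : Set p} (d : Dec P) → [ d ] + [ ¬? d ] ≈ 1#
  []-¬ (yes _) = +-identityʳ 1#
  []-¬ (no _)  = +-identityˡ 1#

  module _ {n : ℕ} where

    private
      S = permutations n

    -- The two hypotheses say that f and g are mutually inverse up to `_≈ₚ_`. Writing h (f p) as a
    -- sum over q of an indicator times h q and exchanging the sums leaves, for each q, the single p
    -- given by g q.
    ∑-reindex : ∀ (f g : Permutation′ n → Permutation′ n) →
                (∀ p q → q ≈ₚ f p → p ≈ₚ g q) → (∀ p q → p ≈ₚ g q → q ≈ₚ f p) →
                ∀ (h : Permutation′ n → Carrier) → Respects h →
                ∑[ p ∈ S ] h (f p) ≈ ∑ S h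
    ∑-reindex f g to from h resp = begin
      ∑[ p ∈ S ] h (f p)
        ≈⟨ ∑-cong S (λ p → ∑-sift (f p) h resp) ⟨
      ∑[ p ∈ S ] ∑[ q ∈ S ] ([ q ≟ₚ f p ] * h q)
        ≈⟨ ∑-comm S S (λ p q → [ q ≟ₚ f p ] * h q) ⟩
      ∑[ q ∈ S ] ∑[ p ∈ S ] ([ q ≟ₚ f p ] * h q)
        ≈⟨ ∑-cong S (λ q → ∑-cong S (λ p → *-congʳ {h q}
             ([]-cong (q ≟ₚ f p) (p ≟ₚ g q) (to p q) (from p q)))) ⟩
      ∑[ q ∈ S ] ∑[ p ∈ S ] ([ p ≟ₚ g q ] * h q)
        ≈⟨ ∑-cong S (λ q → ∑-sift (g q) (λ _ → h q) (λ _ _ _ → refl)) ⟩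
      ∑ S h ∎

    flip-≈ : ∀ (p q : Permutation′ n) → q ≈ₚ flip p → p ≈ₚ flip q
    flip-≈ p q eq = flip-cong (flip p) q (λ i → ≡.sym (eq i))

    ∑-flip : ∀ (h : Permutation′ n → Carrier) → Respects h → ∑[ p ∈ S ] h (flip p) ≈ ∑ S h
    ∑-flip = ∑-reindex flip flip flip-≈ (λ p q → flip-≈ q p)

    -- Splitting the sum by E pairs p with τ p, so that no division by 2 is needed.
    ∑-antisymmetric : ∀ {e} {P E : Permutation′ n → Set e} (P? : Decidable P) (E? : Decidable E)
      (τ : Permutation′ n) →
      (∀ p q → p ≈ₚ q → P p → P q) → (∀ p q → p ≈ₚ q → E p → E q) →
      (∀ p → P p → P (τ ∘′ p)) → (∀ p → P (τ ∘′ p) → P p) →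
      (∀ p → E p → ¬ E (τ ∘′ p)) → (∀ p → ¬ E (τ ∘′ p) → E p) →
      ∀ (h : Permutation′ n → Carrier) → Respects h → (∀ p → h (τ ∘′ p) ≈ - h p) →
      ∑ (filter P? S) h ≈ 0#
    ∑-antisymmetric P? E? τ P-resp E-resp P-τ P-τ⁻¹ E-τ E-τ⁻¹ h h-resp h-τ = begin
      ∑ (filter P? S) h
        ≈⟨ ∑-filter P? S h ⟩
      ∑[ p ∈ S ] ([ P? p ] * h p)
        ≈⟨ ∑-cong S split ⟩
      ∑[ p ∈ S ] (even p + odd p)
        ≈⟨ ∑-+ S even odd ⟩
      ∑ S even + ∑ S odd
        ≈⟨ +-congˡ (∑-translate τ odd odd-resp) ⟨
      ∑ S even + (∑[ p ∈ S ] odd (τ ∘′ p))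
        ≈⟨ ∑-+ S even (λ p → odd (τ ∘′ p)) ⟨
      ∑[ p ∈ S ] (even p + odd (τ ∘′ p))
        ≈⟨ ∑-const0 S cancel ⟩
      0# ∎
      where
      even odd : Permutation′ n → Carrier
      even p = [ E? p ] * ([ P? p ] * h p)
      odd  p = [ ¬? (E? p) ] * ([ P? p ] * h p)

      split : ∀ p → [ P? p ] * h p ≈ even p + odd p
      split p = begin
        [ P? p ] * h p                                    ≈⟨ *-identityˡ _ ⟨
        1# * ([ P? p ] * h p)                             ≈⟨ *-congʳ ([]-¬ (E? p)) ⟨
        ([ E? p ] + [ ¬? (E? p) ]) * ([ P? p ] * h p)     ≈⟨ distribʳ _ _ _ ⟩
        even p + odd p                                    ∎

      odd-resp : Respects odd
      odd-resp p q p≈q = *-cong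
        ([]-cong (¬? (E? p)) (¬? (E? q)) (_∘ E-resp q p (λ i → ≡.sym (p≈q i))) (_∘ E-resp p q p≈q))
        (*-cong ([]-cong (P? p) (P? q) (P-resp p q p≈q) (P-resp q p (λ i → ≡.sym (p≈q i))))
                (h-resp p q p≈q))

      cancel : ∀ p → even p + odd (τ ∘′ p) ≈ 0#
      cancel p = begin
        even p + odd (τ ∘′ p)
          ≈⟨ +-congˡ (*-cong
               ([]-cong (¬? (E? (τ ∘′ p))) (E? p) (E-τ⁻¹ p) (E-τ p))
               (*-cong ([]-cong (P? (τ ∘′ p)) (P? p) (P-τ⁻¹ p) (P-τ p)) (h-τ p))) ⟩
        even p + [ E? p ] * ([ P? p ] * - h p)
          ≈⟨ +-congˡ (*-congˡ (-‿distribʳ-* _ _)) ⟨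
        even p + [ E? p ] * - ([ P? p ] * h p)
          ≈⟨ +-congˡ (-‿distribʳ-* _ _) ⟨
        even p + - even p
          ≈⟨ -‿inverseʳ _ ⟩
        0# ∎

    -- Substituting q for the inverse of p times s makes the right factor the summation variable,
    -- the form suited to right multiplication.
    *ᴳ-coeff : ∀ (a b : Element n) s →
               coeff (a *ᴳ b) s ≈ ∑[ q ∈ S ] (coeff a (s ∘′ flip q) * coeff b q)
    *ᴳ-coeff a b s = begin
      ∑[ p ∈ S ] (coeff a p * coeff b (flip p ∘′ s))
        ≈⟨ ∑-cong S (λ p → *-congʳ {coeff b (flip p ∘′ s)}
             (resp a p (s ∘′ flip (flip p ∘′ s)) (λ i → ≡.sym (Perm.inverseʳ s)))) ⟩
      ∑[ p ∈ S ] (coeff a (s ∘′ flip (flip p ∘′ s)) * coeff b (flip p ∘′ s))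
        ≈⟨ ∑-reindex (λ p → flip p ∘′ s) (λ q → s ∘′ flip q) to from
             (λ q → coeff a (s ∘′ flip q) * coeff b q)
             (λ q r q≈r → *-cong
               (resp a (s ∘′ flip q) (s ∘′ flip r) (λ i → ≡.cong (s ⟨$⟩ʳ_) (flip-cong q r q≈r i)))
               (resp b q r q≈r)) ⟩
      ∑[ q ∈ S ] (coeff a (s ∘′ flip q) * coeff b q) ∎
      where
      to : ∀ p q → q ≈ₚ flip p ∘′ s → p ≈ₚ s ∘′ flip q
      to p q eq i = ≡.trans (≡.sym (Perm.inverseʳ s))
        (≡.cong (s ⟨$⟩ʳ_) (flip-cong (flip p ∘′ s) q (λ j → ≡.sym (eq j)) i))

      from : ∀ p q → p ≈ₚ s ∘′ flip q → q ≈ₚ flip p ∘′ s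
      from p q eq i = ≡.trans (≡.cong (q ⟨$⟩ʳ_) (≡.sym (Perm.inverseˡ s)))
        (flip-cong (s ∘′ flip q) p (λ j → ≡.sym (eq j)) (s ⟨$⟩ʳ i))

    -- In coefficients, this is the eigenvector equation a r = χ(r) a for right multiplication by
    -- every r.
    RightSemiInvariant : (Permutation′ n → Carrier) → Element n → Set ℓ₁
    RightSemiInvariant χ a = ∀ s r → coeff a (s ∘′ flip r) ≈ coeff a s * χ r

    module _ {χ : Permutation′ n → Carrier} where

      -- Right multiplication by b merely rescales a, by the sum of all b(q) χ(q).
      *ᴳ-semiInvariant : ∀ {a} → RightSemiInvariant χ a → ∀ b → RightSemiInvariant χ (a *ᴳ b)
      *ᴳ-semiInvariant {a} inv b s r = begin
        coeff (a *ᴳ b) (s ∘′ flip r)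
          ≈⟨ *ᴳ-coeff a b (s ∘′ flip r) ⟩
        ∑[ q ∈ S ] (coeff a ((s ∘′ flip r) ∘′ flip q) * coeff b q)
          ≈⟨ ∑-cong S (λ q → step q) ⟩
        ∑[ q ∈ S ] (coeff a (s ∘′ flip q) * coeff b q * χ r)
          ≈⟨ ∑-*ʳ S (χ r) (λ q → coeff a (s ∘′ flip q) * coeff b q) ⟨
        (∑[ q ∈ S ] (coeff a (s ∘′ flip q) * coeff b q)) * χ r
          ≈⟨ *-congʳ (*ᴳ-coeff a b s) ⟨
        coeff (a *ᴳ b) s * χ r ∎
        where
        open CommutativeSemigroupProperties *-commutativeSemigroup using (xy∙z≈xz∙y)

        step : ∀ q → coeff a ((s ∘′ flip r) ∘′ flip q) * coeff b q ≈
                     coeff a (s ∘′ flip q) * coeff b q * χ r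
        step q = begin
          coeff a ((s ∘′ flip r) ∘′ flip q) * coeff b q  ≈⟨ *-congʳ (inv (s ∘′ flip r) q) ⟩
          coeff a (s ∘′ flip r) * χ q * coeff b q        ≈⟨ *-congʳ (*-congʳ (inv s r)) ⟩
          coeff a s * χ r * χ q * coeff b q              ≈⟨ *-congʳ (xy∙z≈xz∙y _ _ _) ⟩
          coeff a s * χ q * χ r * coeff b q              ≈⟨ *-congʳ (*-congʳ (inv s q)) ⟨
          coeff a (s ∘′ flip q) * χ r * coeff b q        ≈⟨ xy∙z≈xz∙y _ _ _ ⟩
          coeff a (s ∘′ flip q) * coeff b q * χ r        ∎

      -- Right multiplication by r - χ(r) kills exactly the semi-invariant elements.
      annihilator : Permutation′ n → Element n
      coeff (annihilator r) q = [ q ≟ₚ r ] + [ q ≟ₚ idₚ ] * - χ r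
      resp  (annihilator r) p q p≈q =
        +-cong (resp (δ r) p q p≈q) (*-congʳ (resp (δ idₚ) p q p≈q))

      *ᴳ-annihilator : ∀ a r s →
        coeff (a *ᴳ annihilator r) s ≈ coeff a (s ∘′ flip r) + - (coeff a s * χ r)
      *ᴳ-annihilator a r s = begin
        coeff (a *ᴳ annihilator r) s
          ≈⟨ *ᴳ-coeff a (annihilator r) s ⟩
        ∑[ q ∈ S ] (A q * ([ q ≟ₚ r ] + [ q ≟ₚ idₚ ] * - χ r))
          ≈⟨ ∑-cong S (λ q → trans (distribˡ _ _ _)
               (+-cong (*-comm (A q) [ q ≟ₚ r ]) (x∙yz≈y∙xz (A q) [ q ≟ₚ idₚ ] (- χ r)))) ⟩
        ∑[ q ∈ S ] ([ q ≟ₚ r ] * A q + [ q ≟ₚ idₚ ] * (A q * - χ r))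
          ≈⟨ ∑-+ S (λ q → [ q ≟ₚ r ] * A q) (λ q → [ q ≟ₚ idₚ ] * (A q * - χ r)) ⟩
        ∑[ q ∈ S ] ([ q ≟ₚ r ] * A q) + (∑[ q ∈ S ] ([ q ≟ₚ idₚ ] * (A q * - χ r)))
          ≈⟨ +-cong (∑-sift r A A-resp)
               (∑-sift idₚ (λ q → A q * - χ r) (λ p q p≈q → *-congʳ (A-resp p q p≈q))) ⟩
        A r + A idₚ * - χ r
          ≈⟨ +-congˡ (*-congʳ (resp a (s ∘′ flip idₚ) s (λ _ → ≡.refl))) ⟩
        A r + coeff a s * - χ r
          ≈⟨ +-congˡ (-‿distribʳ-* _ _) ⟨
        A r + - (coeff a s * χ r) ∎
        where
        open CommutativeSemigroupProperties *-commutativeSemigroup using (x∙yz≈y∙xz)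

        A : Permutation′ n → Carrier
        A q = coeff a (s ∘′ flip q)

        A-resp : Respects A
        A-resp p q p≈q = resp a (s ∘′ flip p) (s ∘′ flip q)
          (λ i → ≡.cong (s ⟨$⟩ʳ_) (flip-cong p q p≈q i))

      -- A module isomorphism does not preserve coefficients, but it does preserve being killed by
      -- `annihilator r` from the right. So the image of a is killed, and injectivity pulls this
      -- back to a.
      ≅-semiInvariant : ∀ {ℓ₃} {I : IdealOf n ℓ₃} {y} → RightSemiInvariant χ y →
        I ≅ principal (groupRing n) y → ∀ a → RightIdeal.Member I a → RightSemiInvariant χ a
      ≅-semiInvariant {I = I} {y} inv (φ , iso) a a∈I s r = x∙y⁻¹≈ε⇒x≈y _ _
        (trans (sym (*ᴳ-annihilator a r s)) (a*d≈0 s))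
        where
        open ModuleMorphisms.RightModuleMorphisms (RightIdeal.rawRightModule I)
          (RightIdeal.rawRightModule (principal (groupRing n) y))
        open IsRightModuleIsomorphism iso using (injective; *ᵣ-homo; 0ᴹ-homo)

        x d : Element n
        x = proj₁ (φ (a , a∈I))
        d = annihilator r

        b : Element n
        b = proj₁ (proj₂ (φ (a , a∈I)))

        x≈y*b : x ≈ᴳ y *ᴳ b
        x≈y*b = proj₂ (proj₂ (φ (a , a∈I)))

        x*d≈0 : x *ᴳ d ≈ᴳ 0ᴳ
        x*d≈0 t = trans (*ᴳ-annihilator x r t) (x≈y⇒x∙y⁻¹≈ε
          (trans (x≈y*b (t ∘′ flip r)) (trans (*ᴳ-semiInvariant {y} inv b t r) (*-congʳ (sym (x≈y*b t))))))

        a*d≈0 : a *ᴳ d ≈ᴳ 0ᴳ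
        a*d≈0 = injective {a *ᴳ d , RightIdeal.*-closed I a∈I d} {0ᴳ , RightIdeal.0#-closed I}
          (λ t → trans (*ᵣ-homo d (a , a∈I) t) (trans (x*d≈0 t) (sym (0ᴹ-homo t))))

  -- Factoring powers of -1 through parity carries the finite parity check over to every K.
  -1^_ : Parity → Carrier
  -1^ 0ℙ = 1#
  -1^ 1ℙ = - 1#

  -1^-parity : ∀ m → (- 1#) ^ m ≈ -1^ parity m
  -1^-parity 0             = refl
  -1^-parity 1             = *-identityʳ _
  -1^-parity (suc (suc m)) = begin
    - 1# * (- 1# * (- 1#) ^ m)  ≈⟨ trans (-1*x≈-x _) (-‿cong (-1*x≈-x _)) ⟩
    - (- ((- 1#) ^ m))          ≈⟨ -‿involutive _ ⟩
    (- 1#) ^ m                  ≈⟨ -1^-parity m ⟩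
    -1^ parity m                ∎

  sign-cong : ∀ {n} → Respects {n} sign
  sign-cong p q p≈q = reflexive (≡.cong ((- 1#) ^_) (inversions-cong p q p≈q))

  sign-∘′ : ∀ {n} (p q : Permutation′ n) → ParityAdditive p q → sign (p ∘′ q) ≈ sign p * sign q
  sign-∘′ p q additive = begin
    (- 1#) ^ inversions (p ∘′ q)                  ≈⟨ -1^-parity (inversions (p ∘′ q)) ⟩
    -1^ parity (inversions (p ∘′ q))              ≡⟨ ≡.cong -1^_ additive ⟩
    -1^ parity (inversions p ℕ.+ inversions q)    ≈⟨ -1^-parity (inversions p ℕ.+ inversions q) ⟨
    (- 1#) ^ (inversions p ℕ.+ inversions q)      ≈⟨ ^-homo-* (- 1#) (inversions p) (inversions q) ⟩
    sign p * sign q                               ∎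

  -- Young symmetrizers of one-row and one-column tableaux

  module _ {n} {μ : Partition n} (t : YoungTableau μ) where

    private
      S = permutations n

    -- One of the two groups consists of the identity alone, the other is all of S_n.
    youngSymmetrizer-oneRow : OneRow μ → ∀ r → coeff (youngSymmetrizer t) r ≈ sign {n} idₚ
    youngSymmetrizer-oneRow oneRow r = begin
      ∑[ p ∈ rowGroup t ] ∑[ q ∈ columnGroup t ] (sign q * [ r ≟ₚ p ∘′ q ])
        ≈⟨ ∑-cong (rowGroup t) inner ⟩
      ∑[ p ∈ rowGroup t ] (sign {n} idₚ * [ r ≟ₚ p ])
        ≈⟨ ∑-filter (preservesRows? t) S (λ p → sign {n} idₚ * [ r ≟ₚ p ]) ⟩
      ∑[ p ∈ S ] ([ preservesRows? t p ] * (sign {n} idₚ * [ r ≟ₚ p ]))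
        ≈⟨ ∑-cong S (λ p → trans
             (*-congʳ ([]-true (preservesRows? t p) (λ x → oneRow-row t oneRow _ _)))
             (trans (*-identityˡ _) (trans (*-comm _ _)
             (*-congʳ ([]-cong (r ≟ₚ p) (p ≟ₚ r) (λ eq i → ≡.sym (eq i)) (λ eq i → ≡.sym (eq i))))))) ⟩
      ∑[ p ∈ S ] ([ p ≟ₚ r ] * sign {n} idₚ)
        ≈⟨ ∑-sift r (λ _ → sign {n} idₚ) (λ _ _ _ → refl) ⟩
      sign {n} idₚ ∎
      where
      inner : ∀ p → ∑[ q ∈ columnGroup t ] (sign q * [ r ≟ₚ p ∘′ q ]) ≈ sign {n} idₚ * [ r ≟ₚ p ]
      inner p = begin
        ∑[ q ∈ columnGroup t ] (sign q * [ r ≟ₚ p ∘′ q ])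
          ≈⟨ ∑-filter (preservesColumns? t) S (λ q → sign q * [ r ≟ₚ p ∘′ q ]) ⟩
        ∑[ q ∈ S ] ([ preservesColumns? t q ] * (sign q * [ r ≟ₚ p ∘′ q ]))
          ≈⟨ ∑-cong S (λ q → *-congʳ {sign q * [ r ≟ₚ p ∘′ q ]} ([]-cong (preservesColumns? t q) (q ≟ₚ idₚ)
               (λ pres i → oneRow-column t oneRow _ _ (pres i))
               (λ q≈id i → ≡.cong (column t) (q≈id i)))) ⟩
        ∑[ q ∈ S ] ([ q ≟ₚ idₚ ] * (sign q * [ r ≟ₚ p ∘′ q ]))
          ≈⟨ ∑-sift idₚ (λ q → sign q * [ r ≟ₚ p ∘′ q ]) (λ q q′ q≈q′ → *-cong (sign-cong q q′ q≈q′)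
               ([]-cong (r ≟ₚ p ∘′ q) (r ≟ₚ p ∘′ q′)
                 (λ eq i → ≡.trans (eq i) (≡.cong (p ⟨$⟩ʳ_) (q≈q′ i)))
                 (λ eq i → ≡.trans (eq i) (≡.cong (p ⟨$⟩ʳ_) (≡.sym (q≈q′ i)))))) ⟩
        sign {n} idₚ * [ r ≟ₚ p ∘′ idₚ ]
          ≈⟨ *-congˡ ([]-cong (r ≟ₚ p ∘′ idₚ) (r ≟ₚ p) (λ eq → eq) (λ eq → eq)) ⟩
        sign {n} idₚ * [ r ≟ₚ p ] ∎

    youngSymmetrizer-oneColumn : OneColumn μ → ∀ r → coeff (youngSymmetrizer t) r ≈ sign r
    youngSymmetrizer-oneColumn oneColumn r = begin
      ∑[ p ∈ rowGroup t ] ∑[ q ∈ columnGroup t ] (sign q * [ r ≟ₚ p ∘′ q ])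
        ≈⟨ ∑-cong (rowGroup t) inner ⟩
      ∑[ p ∈ rowGroup t ] sign (flip p ∘′ r)
        ≈⟨ ∑-filter (preservesRows? t) S (λ p → sign (flip p ∘′ r)) ⟩
      ∑[ p ∈ S ] ([ preservesRows? t p ] * sign (flip p ∘′ r))
        ≈⟨ ∑-cong S (λ p → *-congʳ {sign (flip p ∘′ r)} ([]-cong (preservesRows? t p) (p ≟ₚ idₚ)
             (λ pres i → oneColumn-row t oneColumn _ _ (pres i))
             (λ p≈id i → ≡.cong (row t) (p≈id i)))) ⟩
      ∑[ p ∈ S ] ([ p ≟ₚ idₚ ] * sign (flip p ∘′ r))
        ≈⟨ ∑-sift idₚ (λ p → sign (flip p ∘′ r)) (λ p p′ p≈p′ →
             sign-cong (flip p ∘′ r) (flip p′ ∘′ r) (λ i → flip-cong p p′ p≈p′ (r ⟨$⟩ʳ i))) ⟩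
      sign (flip idₚ ∘′ r)
        ≈⟨ sign-cong (flip idₚ ∘′ r) r (λ _ → ≡.refl) ⟩
      sign r ∎
      where
      inner : ∀ p → ∑[ q ∈ columnGroup t ] (sign q * [ r ≟ₚ p ∘′ q ]) ≈ sign (flip p ∘′ r)
      inner p = begin
        ∑[ q ∈ columnGroup t ] (sign q * [ r ≟ₚ p ∘′ q ])
          ≈⟨ ∑-filter (preservesColumns? t) S (λ q → sign q * [ r ≟ₚ p ∘′ q ]) ⟩
        ∑[ q ∈ S ] ([ preservesColumns? t q ] * (sign q * [ r ≟ₚ p ∘′ q ]))
          ≈⟨ ∑-cong S (λ q → trans
               (*-congʳ ([]-true (preservesColumns? t q) (λ x → oneColumn-column t oneColumn _ _)))
               (trans (*-identityˡ _) (trans (*-comm (sign q) [ r ≟ₚ p ∘′ q ])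
               (*-congʳ {sign q} ([]-cong (r ≟ₚ p ∘′ q) (q ≟ₚ flip p ∘′ r) (∘′-cancel p r q) (∘′-uncancel p r q)))))) ⟩
        ∑[ q ∈ S ] ([ q ≟ₚ flip p ∘′ r ] * sign q)
          ≈⟨ ∑-sift (flip p ∘′ r) sign sign-cong ⟩
        sign (flip p ∘′ r) ∎

  module _ {n ℓ₃} {μ : Partition n} {I : IdealOf n ℓ₃} where

    -- All coefficients of y_t have the common value `sign idₚ`, and constancy is semi-invariance
    -- for χ = 1.
    hasClass-oneRow : OneRow μ → HasClass I μ →
                      ∀ a → RightIdeal.Member I a → RightSemiInvariant (const 1#) a
    hasClass-oneRow oneRow (t , I≅) = ≅-semiInvariant {I = I} {youngSymmetrizer t}
      (λ s r → trans (y≈ (s ∘′ flip r)) (sym (trans (*-identityʳ _) (y≈ s)))) I≅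
      where y≈ = youngSymmetrizer-oneRow t oneRow

    -- With `sign ∘ flip` as the character, semi-invariance is literally multiplicativity of `sign`
    -- on s and the inverse of r.
    hasClass-oneColumn : OneColumn μ → (∀ (p q : Permutation′ n) → ParityAdditive p q) →
                         HasClass I μ →
                         ∀ a → RightIdeal.Member I a → RightSemiInvariant (sign ∘ flip) a
    hasClass-oneColumn oneColumn additive (t , I≅) = ≅-semiInvariant {I = I} {youngSymmetrizer t}
      (λ s r → trans (y≈ (s ∘′ flip r))
        (trans (sign-∘′ s (flip r) (additive s (flip r))) (*-congʳ (sym (y≈ s))))) I≅
      where y≈ = youngSymmetrizer-oneColumn t oneColumn

-- Complements of pairs in a five-element set, tables of the row and column groups

-- A total punchOut; omit i i is junk.
omit : ∀ {n} → Fin (suc (suc n)) → Fin (suc (suc n)) → Fin (suc n)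
omit         zero    zero    = zero
omit         zero    (suc j) = j
omit         (suc i) zero    = zero
omit {zero}  (suc i) (suc j) = zero
omit {suc n} (suc i) (suc j) = suc (omit i j)

omit-punchIn : ∀ {n} (i : Fin (suc (suc n))) j → omit i (punchIn i j) ≡ j
omit-punchIn         zero    j       = ≡.refl
omit-punchIn         (suc i) zero    = ≡.refl
omit-punchIn {suc n} (suc i) (suc j) = ≡.cong suc (omit-punchIn i j)

-- For i ≢ j, enumerates the three elements other than i and j.
rest : Fin 5 → Fin 5 → Fin 3 → Fin 5
rest i j k = punchIn i (punchIn (omit i j) k)

-- For distinct i and j, both sides list the same complement in increasing order.
rest-comm : ∀ i j k → rest i j k ≡ rest j i k
rest-comm = from-yes (Fin.all? λ i → Fin.all? λ j → Fin.all? λ k → rest i j k Fin.≟ rest j i k)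

-- The last three values of r are the complement of the first two in some order; removing the first
-- two positions from r leaves exactly the reordering, which a symmetric U cannot see.
rest-permutation : ∀ (r : Permutation′ 5) k →
  r ⟨$⟩ʳ suc (suc k) ≡ rest (r ⟨$⟩ʳ 0F) (r ⟨$⟩ʳ 1F) (remove 0F (remove 0F r) ⟨$⟩ʳ k)
rest-permutation r k = begin
  r ⟨$⟩ʳ suc (suc k)
    ≡⟨ Perm.punchIn-permute r 0F (suc k) ⟩
  punchIn (r ⟨$⟩ʳ 0F) (r′ ⟨$⟩ʳ suc k)
    ≡⟨ ≡.cong (punchIn (r ⟨$⟩ʳ 0F)) (Perm.punchIn-permute r′ 0F k) ⟩
  punchIn (r ⟨$⟩ʳ 0F) (punchIn (r′ ⟨$⟩ʳ 0F) (remove 0F r′ ⟨$⟩ʳ k))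
    ≡⟨ ≡.cong (λ j → punchIn (r ⟨$⟩ʳ 0F) (punchIn j (remove 0F r′ ⟨$⟩ʳ k)))
         (≡.trans (≡.cong (omit (r ⟨$⟩ʳ 0F)) (Perm.punchIn-permute r 0F 0F))
                  (omit-punchIn (r ⟨$⟩ʳ 0F) (r′ ⟨$⟩ʳ 0F))) ⟨
  rest (r ⟨$⟩ʳ 0F) (r ⟨$⟩ʳ 1F) (remove 0F r′ ⟨$⟩ʳ k) ∎
  where
  open ≡.≡-Reasoning
  r′ = remove 0F r

-- Moves the two factors of U ⊗ T past each other: 0 ↦ 3, 1 ↦ 4, 2 ↦ 0, 3 ↦ 1, 4 ↦ 2.
rotation : Permutation′ 5
rotation = insert 0F 3F (insert 0F 3F idₚ)

-- Tables instead of permutations: an equation between lists of permutations would also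
-- have to compare the proofs that they are inverse to each other.
inverseTable : ∀ {n} → Permutation′ n → Vec (Fin n) n
inverseTable p = Vec.tabulate (flip p ⟨$⟩ʳ_)

lookup-inverseTable : ∀ {n} (p : Permutation′ n) i → Vec.lookup (inverseTable p) i ≡ flip p ⟨$⟩ʳ i
lookup-inverseTable p = Vec.lookup∘tabulate (flip p ⟨$⟩ʳ_)

signedTable : ∀ {n} → Permutation′ n → ℕ × Vec (Fin n) n
signedTable p = inversions p , inverseTable p

-- The group generated by the swaps of 0 with 1 and of 2 with 3. This list and `rowTables` follow
-- the order of `permutations`, so that both comparisons hold by evaluation.
columnTables : List (ℕ × Vec (Fin 5) 5)
columnTables = (0 , 0F ∷ 1F ∷ 2F ∷ 3F ∷ 4F ∷ []) ∷ (1 , 0F ∷ 1F ∷ 3F ∷ 2F ∷ 4F ∷ [])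
             ∷ (1 , 1F ∷ 0F ∷ 2F ∷ 3F ∷ 4F ∷ []) ∷ (2 , 1F ∷ 0F ∷ 3F ∷ 2F ∷ 4F ∷ []) ∷ []

rowTables : List (Vec (Fin 5) 5)
rowTables = (0F ∷ 1F ∷ 2F ∷ 3F ∷ 4F ∷ []) ∷ (0F ∷ 1F ∷ 4F ∷ 3F ∷ 2F ∷ [])
          ∷ (0F ∷ 3F ∷ 2F ∷ 1F ∷ 4F ∷ []) ∷ (0F ∷ 3F ∷ 4F ∷ 1F ∷ 2F ∷ [])
          ∷ (2F ∷ 1F ∷ 0F ∷ 3F ∷ 4F ∷ []) ∷ (4F ∷ 1F ∷ 0F ∷ 3F ∷ 2F ∷ [])
          ∷ (2F ∷ 3F ∷ 0F ∷ 1F ∷ 4F ∷ []) ∷ (4F ∷ 3F ∷ 0F ∷ 1F ∷ 2F ∷ [])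
          ∷ (2F ∷ 1F ∷ 4F ∷ 3F ∷ 0F ∷ []) ∷ (4F ∷ 1F ∷ 2F ∷ 3F ∷ 0F ∷ [])
          ∷ (2F ∷ 3F ∷ 4F ∷ 1F ∷ 0F ∷ []) ∷ (4F ∷ 3F ∷ 2F ∷ 1F ∷ 0F ∷ []) ∷ []

rowGroup-tables : List.map inverseTable (rowGroup tableau-135-24) ≡ rowTables
rowGroup-tables = ≡.refl

columnGroup-tables : List.map signedTable (columnGroup tableau-135-24) ≡ columnTables
columnGroup-tables = ≡.refl

preservesRows-transpose₀₂ : PreservesRows tableau-135-24 (transpose 0F 2F)
preservesRows-transpose₀₂ = from-yes (preservesRows? tableau-135-24 (transpose 0F 2F))

preservesRows-transpose₂₄ : PreservesRows tableau-135-24 (transpose 2F 4F)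
preservesRows-transpose₂₄ = from-yes (preservesRows? tableau-135-24 (transpose 2F 4F))

-- Antisymmetrizing over the columns and summing over the rows

module RowColumnSums {c ℓ₁ ℓ₂ : Level} (K : HeytingField c ℓ₁ ℓ₂) where

  open CommutativeRing (commutativeRing K) hiding (zero)
  open GroupRing K
  open GroupRingProperties K
  open RawSemiringDefs (Semiring.rawSemiring semiring) using (_^_)
  open RingProperties ring
    using (-‿distribʳ-*; -1*x≈-x; -‿involutive; -0#≈0#; -‿+-comm; ⁻¹-anti-homo-//)
  open SetoidReasoning setoid

  ∑-columns : ∀ (f : Vec (Fin 5) 5 → Carrier) → let v = λ i → proj₂ (lookup columnTables i) in
    ∑[ (k , w) ∈ columnTables ] ((- 1#) ^ k * f w) ≈ (f (v 0F) - f (v 1F)) - (f (v 2F) - f (v 3F))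
  ∑-columns f = begin
    -- The powers of -1 appear unfolded, with exponents 0, 1, 1, 2 from `columnTables`.
    1# * f (v 0F) + ((- 1# * 1#) * f (v 1F)
      + ((- 1# * 1#) * f (v 2F) + ((- 1# * (- 1# * 1#)) * f (v 3F) + 0#)))
      ≈⟨ +-cong (*-identityˡ _) (+-cong (-1*1* _) (+-cong (-1*1* _) (trans (+-identityʳ _)
           (trans (*-assoc _ _ _) (trans (-1*x≈-x _) (-‿cong (-1*1* _))))))) ⟩
    f (v 0F) + (- f (v 1F) + (- f (v 2F) + - (- f (v 3F))))
      ≈⟨ +-assoc _ _ _ ⟨
    (f (v 0F) - f (v 1F)) + (- f (v 2F) + - (- f (v 3F)))
      ≈⟨ +-congˡ (-‿+-comm _ _) ⟩
    (f (v 0F) - f (v 1F)) - (f (v 2F) - f (v 3F)) ∎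
    where
    v : Fin 4 → Vec (Fin 5) 5
    v i = proj₂ (lookup columnTables i)

    -1*1* : ∀ x → - 1# * 1# * x ≈ - x
    -1*1* x = trans (*-congʳ (*-identityʳ _)) (-1*x≈-x x)

  module _ (X : Fin 5 → Fin 5 → Carrier) (X-antisym : ∀ i j → X j i ≈ - X i j) where

    D : Fin 5 → Fin 5 → Carrier
    D i j = ∑[ (k , w) ∈ columnTables ] ((- 1#) ^ k * X (Vec.lookup w i) (Vec.lookup w j))

    D-expand : ∀ i j → let X′ = λ w → X (Vec.lookup w i) (Vec.lookup w j)
                           v = λ i → proj₂ (lookup columnTables i) in
               D i j ≈ (X′ (v 0F) - X′ (v 1F)) - (X′ (v 2F) - X′ (v 3F))
    D-expand i j = ∑-columns (λ w → X (Vec.lookup w i) (Vec.lookup w j))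

    D-antisym : ∀ i j → D j i ≈ - D i j
    D-antisym i j = begin
      D j i
        ≈⟨ ∑-cong columnTables (λ (k , w) → trans
             (*-congˡ {(- 1#) ^ k} (X-antisym (Vec.lookup w i) (Vec.lookup w j)))
             (trans (sym (-‿distribʳ-* _ _)) (sym (-1*x≈-x _)))) ⟩
      ∑[ (k , w) ∈ columnTables ] (- 1# * ((- 1#) ^ k * X (Vec.lookup w i) (Vec.lookup w j)))
        ≈⟨ ∑-*ˡ columnTables (- 1#) (λ (k , w) → (- 1#) ^ k * X (Vec.lookup w i) (Vec.lookup w j)) ⟨
      - 1# * D i j
        ≈⟨ -1*x≈-x _ ⟩
      - D i j ∎

    D-flip : ∀ i j → D i j ≈ 0# → D j i ≈ 0#
    D-flip i j Dij≈0 = trans (D-antisym i j) (trans (-‿cong Dij≈0) -0#≈0#)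

    same : ∀ x y → (x - x) - (y - y) ≈ 0#
    same x y = trans (+-cong (-‿inverseʳ x) (-‿cong (-‿inverseʳ y))) (-‿inverseʳ 0#)

    -- The swap of 2 and 3 is an odd column permutation fixing 0, 1 and 4, so the four terms of
    -- `D01` and of `D41` cancel in pairs. The swap of 0 and 1 does the same for `D23` and `D43`.
    D01 : D 0F 1F ≈ 0#
    D01 = trans (D-expand 0F 1F) (same (X 0F 1F) (X 1F 0F))

    D10 : D 1F 0F ≈ 0#
    D10 = D-flip 0F 1F D01

    D41 : D 4F 1F ≈ 0#
    D41 = trans (D-expand 4F 1F) (same (X 4F 1F) (X 4F 0F))

    D14 : D 1F 4F ≈ 0#
    D14 = D-flip 4F 1F D41

    D23 : D 2F 3F ≈ 0#
    D23 = trans (D-expand 2F 3F) (-‿inverseʳ (X 2F 3F - X 3F 2F))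

    D32 : D 3F 2F ≈ 0#
    D32 = D-flip 2F 3F D23

    D43 : D 4F 3F ≈ 0#
    D43 = trans (D-expand 4F 3F) (-‿inverseʳ (X 4F 3F - X 4F 2F))

    D34 : D 3F 4F ≈ 0#
    D34 = D-flip 4F 3F D43

    -- The product of the two column swaps is even and takes (0 , 3) to (1 , 2), so both values
    -- consist of the same four signed terms.
    D12 : D 1F 2F ≈ D 0F 3F
    D12 = begin
      D 1F 2F
        ≈⟨ D-expand 1F 2F ⟩
      (X 1F 2F - X 1F 3F) - (X 0F 2F - X 0F 3F)
        ≈⟨ +-cong (sym (⁻¹-anti-homo-// _ _)) (⁻¹-anti-homo-// _ _) ⟩
      - (X 1F 3F - X 1F 2F) + (X 0F 3F - X 0F 2F)
        ≈⟨ +-comm _ _ ⟩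
      (X 0F 3F - X 0F 2F) - (X 1F 3F - X 1F 2F)
        ≈⟨ D-expand 0F 3F ⟨
      D 0F 3F ∎

    D21 : D 2F 1F ≈ - D 0F 3F
    D21 = trans (D-antisym 1F 2F) (-‿cong D12)

    infixr 5 _∷₀_
    _∷₀_ : ∀ {x y z} → x ≈ 0# → y ≈ z → x + y ≈ z
    x≈0 ∷₀ y≈z = trans (+-cong x≈0 y≈z) (+-identityˡ _)

    x+x-x-x≈0 : ∀ x → x + (x + (- x + - x)) ≈ 0#
    x+x-x-x≈0 x = begin
      x + (x + (- x + - x))  ≈⟨ +-assoc _ _ _ ⟨
      (x + x) + (- x + - x)  ≈⟨ +-congˡ (-‿+-comm x x) ⟩
      (x + x) - (x + x)      ≈⟨ -‿inverseʳ _ ⟩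
      0#                     ∎

    -- The row group takes (0 , 1) twice to each pair with first entry in {0, 2, 4} and second in
    -- {1, 3}. Four of these six pairs contribute nothing.
    ∑-D₀₁ : ∑[ w ∈ rowTables ] D (Vec.lookup w 0F) (Vec.lookup w 1F) ≈ 0#
    ∑-D₀₁ = trans
      (D01 ∷₀ D01 ∷₀ +-congˡ (+-congˡ (+-cong D21 (D41 ∷₀ D23 ∷₀ D43 ∷₀
        trans (+-cong D21 (D41 ∷₀ D23 ∷₀ D43 ∷₀ refl)) (+-identityʳ _)))))
      (x+x-x-x≈0 (D 0F 3F))

    -- Here the pairs have first entry in {1, 3} and second in {0, 2, 4}, each again twice; (1 , 2)
    -- and (3 , 0) survive.
    ∑-D₃₄ : ∑[ w ∈ rowTables ] D (Vec.lookup w 3F) (Vec.lookup w 4F) ≈ 0#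
    ∑-D₃₄ = trans
      (D34 ∷₀ D32 ∷₀ D14 ∷₀
        +-cong D12 (D34 ∷₀ D32 ∷₀ D14 ∷₀
        +-cong D12 (+-cong (D-antisym 0F 3F) (trans
          (+-cong (D-antisym 0F 3F) (D10 ∷₀ D10 ∷₀ refl)) (+-identityʳ _)))))
      (x+x-x-x≈0 (D 0F 3F))

    module _ {μ : Partition 5} (t : YoungTableau μ)
             (rows    : List.map inverseTable (rowGroup t) ≡ rowTables)
             (columns : List.map signedTable (columnGroup t) ≡ columnTables) where

      ∑-row-column : ∀ i j →
        ∑[ p ∈ rowGroup t ] ∑[ q ∈ columnGroup t ]
          (sign q * X (flip (p ∘′ q) ⟨$⟩ʳ i) (flip (p ∘′ q) ⟨$⟩ʳ j)) ≈
        ∑[ w ∈ rowTables ] D (Vec.lookup w i) (Vec.lookup w j)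
      ∑-row-column i j = begin
        -- The inverse of the product applies the inverse of p first, so for fixed p the sum over q
        -- is a value of `D`.
        ∑[ p ∈ R ] ∑[ q ∈ C ] (sign q * X (flip q ⟨$⟩ʳ (flip p ⟨$⟩ʳ i)) (flip q ⟨$⟩ʳ (flip p ⟨$⟩ʳ j)))
          ≈⟨ ∑-cong R (λ p → inner (flip p ⟨$⟩ʳ i) (flip p ⟨$⟩ʳ j)) ⟩
        ∑[ p ∈ R ] D (flip p ⟨$⟩ʳ i) (flip p ⟨$⟩ʳ j)
          ≈⟨ ∑-cong R (λ p → reflexive (≡.cong₂ D (lookup-inverseTable p i) (lookup-inverseTable p j))) ⟨
        ∑[ p ∈ R ] D (Vec.lookup (inverseTable p) i) (Vec.lookup (inverseTable p) j)
          ≈⟨ ∑-map inverseTable R (λ w → D (Vec.lookup w i) (Vec.lookup w j)) ⟨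
        ∑ (List.map inverseTable R) (λ w → D (Vec.lookup w i) (Vec.lookup w j))
          ≡⟨ ≡.cong (λ xs → ∑ xs (λ w → D (Vec.lookup w i) (Vec.lookup w j))) rows ⟩
        ∑[ w ∈ rowTables ] D (Vec.lookup w i) (Vec.lookup w j) ∎
        where
        R = rowGroup t
        C = columnGroup t

        inner : ∀ k l → ∑[ q ∈ C ] (sign q * X (flip q ⟨$⟩ʳ k) (flip q ⟨$⟩ʳ l)) ≈ D k l
        inner k l = begin
          ∑[ q ∈ C ] (sign q * X (flip q ⟨$⟩ʳ k) (flip q ⟨$⟩ʳ l))
            ≈⟨ ∑-cong C (λ q → *-congˡ {sign q} (reflexive
                 (≡.cong₂ X (lookup-inverseTable q k) (lookup-inverseTable q l)))) ⟨
          ∑[ q ∈ C ] f (signedTable q)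
            ≈⟨ ∑-map signedTable C f ⟨
          ∑ (List.map signedTable C) f
            ≡⟨ ≡.cong (λ xs → ∑ xs f) columns ⟩
          D k l ∎
          where
          f : ℕ × Vec (Fin 5) 5 → Carrier
          f (e , w) = (- 1#) ^ e * X (Vec.lookup w k) (Vec.lookup w l)

-- Symmetrizing tensor products

module TensorProperties {c ℓ₁ ℓ₂ m ℓm : Level} (K : HeytingField c ℓ₁ ℓ₂)
                        (V : Module (commutativeRing K) m ℓm) where

  open CommutativeRing (commutativeRing K) hiding (zero)
  open Module V using (Carrierᴹ)
  open GroupRing K
  open GroupRingProperties K
  open RowColumnSums K
  open Tensors K V
  open RingProperties ring
    using (-‿distribˡ-*; -‿distribʳ-*; -1*x≈-x; -‿involutive)
  open SetoidReasoning setoid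

  _∘ᵥ_ : ∀ {r} → Vector Carrierᴹ r → Permutation′ r → Vector Carrierᴹ r
  v ∘ᵥ p = v ∘ (p ⟨$⟩ʳ_)

  -- Permuting the arguments of a T multiplies a by r from the left, whereas a lies in a right
  -- ideal. The bridge is that right semi-invariance at the identity gives a(p) = a(1) χ(p⁻¹), which
  -- for multiplicative χ is semi-invariant on the left too.
  symmetryClass-permute : ∀ {n ℓ₃} {I : IdealOf n ℓ₃} {χ : Permutation′ n → Carrier} →
    (∀ a → RightIdeal.Member I a → RightSemiInvariant χ a) →
    (∀ p q → χ (p ∘′ q) ≈ χ p * χ q) →
    ∀ T → SymmetryClass I T → ∀ r v → ⟦ T ⟧ (v ∘ᵥ r) ≈ χ r * ⟦ T ⟧ v
  symmetryClass-permute {n} {I = I} {χ} inv χ-∘′ T (a , a∈I , T₀ , T≈) r v = begin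
    ⟦ T ⟧ (v ∘ᵥ r)
      ≈⟨ T≈ (v ∘ᵥ r) ⟩
    ∑[ p ∈ S ] (coeff a p * ⟦ T₀ ⟧ (v ∘ᵥ (r ∘′ p)))
      ≈⟨ ∑-cong S (λ p → *-congʳ {⟦ T₀ ⟧ (v ∘ᵥ (r ∘′ p))}
           (resp a p (flip r ∘′ (r ∘′ p)) (λ i → ≡.sym (Perm.inverseˡ r)))) ⟩
    ∑[ p ∈ S ] (coeff a (flip r ∘′ (r ∘′ p)) * ⟦ T₀ ⟧ (v ∘ᵥ (r ∘′ p)))
      ≈⟨ ∑-translate r (λ p → coeff a (flip r ∘′ p) * ⟦ T₀ ⟧ (v ∘ᵥ p)) (λ p q p≈q → *-cong
           (resp a (flip r ∘′ p) (flip r ∘′ q) (λ i → ≡.cong (flip r ⟨$⟩ʳ_) (p≈q i)))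
           (⟦⟧-cong-≡ T₀ (λ i → ≡.cong v (p≈q i)))) ⟩
    ∑[ p ∈ S ] (coeff a (flip r ∘′ p) * ⟦ T₀ ⟧ (v ∘ᵥ p))
      ≈⟨ ∑-cong S (λ p → trans (*-congʳ {⟦ T₀ ⟧ (v ∘ᵥ p)} (left p)) (*-assoc _ _ _)) ⟩
    ∑[ p ∈ S ] (χ r * (coeff a p * ⟦ T₀ ⟧ (v ∘ᵥ p)))
      ≈⟨ ∑-*ˡ S (χ r) (λ p → coeff a p * ⟦ T₀ ⟧ (v ∘ᵥ p)) ⟨
    χ r * ⟦ a · T₀ ⟧ v
      ≈⟨ *-congˡ (T≈ v) ⟨
    χ r * ⟦ T ⟧ v ∎
    where
    S = permutations n

    coeff-flip : ∀ p → coeff a (flip p) ≈ coeff a idₚ * χ p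
    coeff-flip p = trans (resp a (flip p) (idₚ ∘′ flip p) (λ _ → ≡.refl)) (inv a a∈I idₚ p)

    left : ∀ p → coeff a (flip r ∘′ p) ≈ χ r * coeff a p
    left p = begin
      coeff a (flip r ∘′ p)                  ≈⟨ resp a (flip r ∘′ p) (flip (flip p ∘′ r)) (λ _ → ≡.refl) ⟩
      coeff a (flip (flip p ∘′ r))           ≈⟨ coeff-flip (flip p ∘′ r) ⟩
      coeff a idₚ * χ (flip p ∘′ r)          ≈⟨ *-congˡ (χ-∘′ (flip p) r) ⟩
      coeff a idₚ * (χ (flip p) * χ r)       ≈⟨ *-assoc _ _ _ ⟨
      coeff a idₚ * χ (flip p) * χ r         ≈⟨ *-congʳ (coeff-flip (flip p)) ⟨
      coeff a (flip (flip p)) * χ r          ≈⟨ *-comm _ _ ⟩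
      χ r * coeff a (flip (flip p))          ≈⟨ *-congˡ (resp a (flip (flip p)) p (λ _ → ≡.refl)) ⟩
      χ r * coeff a p                        ∎

  module _ {n ℓ₃} {μ : Partition n} {I : IdealOf n ℓ₃} (T : Tensor n) where

    oneRow-symmetric : OneRow μ → HasClass I μ → SymmetryClass I T →
                       ∀ r v → ⟦ T ⟧ (v ∘ᵥ r) ≈ ⟦ T ⟧ v
    oneRow-symmetric oneRow class T∈ r v = trans
      (symmetryClass-permute {I = I} {const 1#} (hasClass-oneRow {μ = μ} {I} oneRow class)
        (λ _ _ → sym (*-identityˡ 1#)) T T∈ r v)
      (*-identityˡ _)

    oneColumn-alternating : OneColumn μ → (∀ (p q : Permutation′ n) → ParityAdditive p q) →
      HasClass I μ → SymmetryClass I T → ∀ r v → ⟦ T ⟧ (v ∘ᵥ r) ≈ sign (flip r) * ⟦ T ⟧ v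
    oneColumn-alternating oneColumn additive class T∈ =
      symmetryClass-permute {I = I} {sign ∘ flip} (hasClass-oneColumn {μ = μ} {I} oneColumn additive class)
        (λ p q → trans
          (trans (sign-cong (flip (p ∘′ q)) (flip q ∘′ flip p) (λ _ → ≡.refl))
                 (sign-∘′ (flip q) (flip p) (additive (flip q) (flip p))))
          (*-comm _ _)) T T∈

  module _ {n} {μ : Partition n} (t : YoungTableau μ) where

    private
      S = permutations n

    -- Reindexing by inversion moves the `⋆` from the coefficients to the arguments; each δ in y_t
    -- then selects one permutation.
    youngSymmetrizer⋆-· : ∀ F v → ⟦ youngSymmetrizer t ⋆ · F ⟧ v ≈
      ∑[ p ∈ rowGroup t ] ∑[ q ∈ columnGroup t ] (sign q * ⟦ F ⟧ (v ∘ᵥ flip (p ∘′ q)))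
    youngSymmetrizer⋆-· F v = begin
      ∑[ r ∈ S ] (coeff y (flip r) * ⟦ F ⟧ (v ∘ᵥ r))
        ≈⟨ ∑-flip (λ r → coeff y r * f r) (λ r s r≈s → *-cong (resp y r s r≈s) (f-resp r s r≈s)) ⟩
      ∑[ r ∈ S ] (coeff y r * f r)
        ≈⟨ ∑-cong S (λ r → trans
             (∑-*ʳ (rowGroup t) (f r) (λ p → ∑[ q ∈ columnGroup t ] (sign q * [ r ≟ₚ p ∘′ q ])))
             (∑-cong (rowGroup t) (λ p →
               ∑-*ʳ (columnGroup t) (f r) (λ q → sign q * [ r ≟ₚ p ∘′ q ])))) ⟩
      ∑[ r ∈ S ] ∑[ p ∈ rowGroup t ] ∑[ q ∈ columnGroup t ] (sign q * [ r ≟ₚ p ∘′ q ] * f r)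
        ≈⟨ ∑-comm S (rowGroup t) (λ r p → ∑[ q ∈ columnGroup t ] (sign q * [ r ≟ₚ p ∘′ q ] * f r)) ⟩
      ∑[ p ∈ rowGroup t ] ∑[ r ∈ S ] ∑[ q ∈ columnGroup t ] (sign q * [ r ≟ₚ p ∘′ q ] * f r)
        ≈⟨ ∑-cong (rowGroup t) (λ p →
             ∑-comm S (columnGroup t) (λ r q → sign q * [ r ≟ₚ p ∘′ q ] * f r)) ⟩
      ∑[ p ∈ rowGroup t ] ∑[ q ∈ columnGroup t ] ∑[ r ∈ S ] (sign q * [ r ≟ₚ p ∘′ q ] * f r)
        ≈⟨ ∑-cong (rowGroup t) (λ p → ∑-cong (columnGroup t) (λ q → sift (p ∘′ q) (sign q))) ⟩
      ∑[ p ∈ rowGroup t ] ∑[ q ∈ columnGroup t ] (sign q * f (p ∘′ q)) ∎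
      where
      y = youngSymmetrizer t

      f : Permutation′ n → Carrier
      f r = ⟦ F ⟧ (v ∘ᵥ flip r)

      f-resp : Respects f
      f-resp r s r≈s = ⟦⟧-cong-≡ F (λ i → ≡.cong v (flip-cong r s r≈s i))

      sift : ∀ s k → ∑[ r ∈ S ] (k * [ r ≟ₚ s ] * f r) ≈ k * f s
      sift s k = begin
        ∑[ r ∈ S ] (k * [ r ≟ₚ s ] * f r)    ≈⟨ ∑-cong S (λ r → *-assoc k [ r ≟ₚ s ] (f r)) ⟩
        ∑[ r ∈ S ] (k * ([ r ≟ₚ s ] * f r))  ≈⟨ ∑-*ˡ S k (λ r → [ r ≟ₚ s ] * f r) ⟨
        k * ∑[ r ∈ S ] ([ r ≟ₚ s ] * f r)    ≈⟨ *-congˡ (∑-sift s f f-resp) ⟩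
        k * f s                              ∎

    -- Left multiplication by τ permutes the row group, so the row symmetrizer already kills F.
    youngSymmetrizer⋆-row-alternating : ∀ τ {i j} → i ≢ j → flip τ ⟨$⟩ʳ i ≡ j → flip τ ⟨$⟩ʳ j ≡ i →
      PreservesRows t τ → ∀ F → (∀ v → ⟦ F ⟧ (v ∘ᵥ flip τ) ≈ - ⟦ F ⟧ v) →
      youngSymmetrizer t ⋆ · F ≈ᵀ 0ᵀ
    youngSymmetrizer⋆-row-alternating τ {i} {j} i≢j τi≡j τj≡i τ-rows F alternating v = begin
      ⟦ youngSymmetrizer t ⋆ · F ⟧ v
        ≈⟨ youngSymmetrizer⋆-· F v ⟩
      ∑[ p ∈ rowGroup t ] ∑[ q ∈ columnGroup t ] (sign q * ⟦ F ⟧ (v ∘ᵥ flip (p ∘′ q)))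
        ≈⟨ ∑-comm (rowGroup t) (columnGroup t) (λ p q → sign q * ⟦ F ⟧ (v ∘ᵥ flip (p ∘′ q))) ⟩
      ∑[ q ∈ columnGroup t ] ∑[ p ∈ rowGroup t ] (sign q * ⟦ F ⟧ (v ∘ᵥ flip (p ∘′ q)))
        ≈⟨ ∑-cong (columnGroup t) (λ q →
             ∑-*ˡ (rowGroup t) (sign q) (λ p → ⟦ F ⟧ (v ∘ᵥ flip (p ∘′ q)))) ⟨
      ∑[ q ∈ columnGroup t ] (sign q * ∑[ p ∈ rowGroup t ] ⟦ F ⟧ (v ∘ᵥ flip (p ∘′ q)))
        ≈⟨ ∑-const0 (columnGroup t) (λ q →
             trans (*-congˡ {sign q} (rowSum (v ∘ᵥ flip q))) (zeroʳ (sign q))) ⟩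
      0# ∎
      where
      -- The order of the images of i and j under the inverse of p splits the row group into two
      -- halves. Left multiplication by τ exchanges them, because the inverse of τ swaps i and j.
      _precedes-in_ : Fin n × Fin n → Permutation′ n → Set
      (k , l) precedes-in p = flip p ⟨$⟩ʳ k < flip p ⟨$⟩ʳ l

      swapped : ∀ p → (i , j) precedes-in (τ ∘′ p) ≡ (j , i) precedes-in p
      swapped p = ≡.cong₂ (λ k l → (k , l) precedes-in p) τi≡j τj≡i

      trichotomy : ∀ p → ¬ (j , i) precedes-in p → (i , j) precedes-in p
      trichotomy p j≮i with Fin.<-cmp (flip p ⟨$⟩ʳ i) (flip p ⟨$⟩ʳ j)
      ... | tri< i<j _ _ = i<j
      ... | tri≈ _ eq _  = contradiction
        (≡.trans (≡.sym (Perm.inverseʳ p)) (≡.trans (≡.cong (p ⟨$⟩ʳ_) eq) (Perm.inverseʳ p))) i≢j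
      ... | tri> _ _ j<i = contradiction j<i j≮i

      rowSum : ∀ w → ∑[ p ∈ rowGroup t ] ⟦ F ⟧ (w ∘ᵥ flip p) ≈ 0#
      rowSum w = ∑-antisymmetric (preservesRows? t)
        (λ p → flip p ⟨$⟩ʳ i Fin.<? flip p ⟨$⟩ʳ j) τ
        (λ p q p≈q p-rows x → ≡.trans (≡.cong (row t) (≡.sym (p≈q x))) (p-rows x))
        (λ p q p≈q → ≡.subst₂ _<_ (flip-cong p q p≈q i) (flip-cong p q p≈q j))
        (λ p p-rows x → ≡.trans (τ-rows (p ⟨$⟩ʳ x)) (p-rows x))
        (λ p τp-rows x → ≡.trans (≡.sym (τ-rows (p ⟨$⟩ʳ x))) (τp-rows x))
        (λ p i<j τi<τj → Fin.<-asym i<j (≡.subst (λ A → A) (swapped p) τi<τj))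
        (λ p τi≮τj → trichotomy p (τi≮τj ∘ ≡.subst (λ A → A) (≡.sym (swapped p))))
        (λ p → ⟦ F ⟧ (w ∘ᵥ flip p))
        (λ p q p≈q → ⟦⟧-cong-≡ F (λ k → ≡.cong w (flip-cong p q p≈q k)))
        (λ p → alternating (w ∘ᵥ flip p))

  alternating₃-τ₀₂ : ∀ (U : Tensor 3) → (∀ r v → ⟦ U ⟧ (v ∘ᵥ r) ≈ sign (flip r) * ⟦ U ⟧ v) →
                     ∀ v → ⟦ U ⟧ (v ∘ᵥ transpose 0F 2F) ≈ - ⟦ U ⟧ v
  alternating₃-τ₀₂ U alternating v = begin
    ⟦ U ⟧ (v ∘ᵥ transpose 0F 2F)
      ≈⟨ alternating (transpose 0F 2F) v ⟩
    -- The swap of 0 and 2 in three letters has three inversions.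
    - 1# * (- 1# * (- 1# * 1#)) * ⟦ U ⟧ v
      ≈⟨ *-congʳ (trans (-1*x≈-x _) (trans (-‿cong (trans (-1*x≈-x _) (-‿cong (-1*x≈-x _)))) (-‿involutive _))) ⟩
    - 1# * ⟦ U ⟧ v
      ≈⟨ -1*x≈-x _ ⟩
    - ⟦ U ⟧ v ∎

  module _ (T : Tensor 2) (U : Tensor 3)
           (alternating : ∀ r v → ⟦ U ⟧ (v ∘ᵥ r) ≈ sign (flip r) * ⟦ U ⟧ v) where

    -- Positions 2 and 4 are the outer arguments of U in `T ⊗ U`; in `U ⊗ T` these are 0 and 2. Both
    -- pairs lie in the row {0, 2, 4}.
    ⊗-alternating : ∀ v → ⟦ T ⊗ U ⟧ (v ∘ᵥ flip (transpose 2F 4F)) ≈ - ⟦ T ⊗ U ⟧ v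
    ⊗-alternating v = begin
      ⟦ T ⊗ U ⟧ (v ∘ᵥ flip (transpose 2F 4F))
        ≈⟨ *-cong (⟦⟧-cong-≡ T λ { 0F → ≡.refl ; 1F → ≡.refl })
                  (⟦⟧-cong-≡ U λ { 0F → ≡.refl ; 1F → ≡.refl ; 2F → ≡.refl }) ⟩
      ⟦ T ⟧ (v ∘ (_↑ˡ 3)) * ⟦ U ⟧ ((v ∘ (2 ↑ʳ_)) ∘ᵥ transpose 0F 2F)
        ≈⟨ *-congˡ (alternating₃-τ₀₂ U alternating (v ∘ (2 ↑ʳ_))) ⟩
      ⟦ T ⟧ (v ∘ (_↑ˡ 3)) * - ⟦ U ⟧ (v ∘ (2 ↑ʳ_))
        ≈⟨ -‿distribʳ-* _ _ ⟨
      - ⟦ T ⊗ U ⟧ v ∎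

    alternating-⊗ : ∀ v → ⟦ U ⊗ T ⟧ (v ∘ᵥ flip (transpose 0F 2F)) ≈ - ⟦ U ⊗ T ⟧ v
    alternating-⊗ v = begin
      ⟦ U ⊗ T ⟧ (v ∘ᵥ flip (transpose 0F 2F))
        ≈⟨ *-cong (⟦⟧-cong-≡ U λ { 0F → ≡.refl ; 1F → ≡.refl ; 2F → ≡.refl })
                  (⟦⟧-cong-≡ T λ { 0F → ≡.refl ; 1F → ≡.refl }) ⟩
      ⟦ U ⟧ ((v ∘ (_↑ˡ 2)) ∘ᵥ transpose 0F 2F) * ⟦ T ⟧ (v ∘ (3 ↑ʳ_))
        ≈⟨ *-congʳ (alternating₃-τ₀₂ U alternating (v ∘ (_↑ˡ 2))) ⟩
      - ⟦ U ⟧ (v ∘ (_↑ˡ 2)) * ⟦ T ⟧ (v ∘ (3 ↑ʳ_))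
        ≈⟨ -‿distribˡ-* _ _ ⟨
      - ⟦ U ⊗ T ⟧ v ∎

    module _ {μ : Partition 5} (t : YoungTableau μ) where

      youngSymmetrizer⋆-⊗-alternating : PreservesRows t (transpose 2F 4F) →
        youngSymmetrizer t ⋆ · (T ⊗ U) ≈ᵀ 0ᵀ
      youngSymmetrizer⋆-⊗-alternating rows = youngSymmetrizer⋆-row-alternating t (transpose 2F 4F)
        {2F} {4F} (λ ()) ≡.refl ≡.refl rows (T ⊗ U) ⊗-alternating

      youngSymmetrizer⋆-alternating-⊗ : PreservesRows t (transpose 0F 2F) →
        youngSymmetrizer t ⋆ · (U ⊗ T) ≈ᵀ 0ᵀ
      youngSymmetrizer⋆-alternating-⊗ rows v = youngSymmetrizer⋆-row-alternating t (transpose 0F 2F)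
        {0F} {2F} (λ ()) ≡.refl ≡.refl rows (U ⊗ T) alternating-⊗ v

  module _ {μ : Partition 5} (t : YoungTableau μ)
           (rows    : List.map inverseTable (rowGroup t) ≡ rowTables)
           (columns : List.map signedTable (columnGroup t) ≡ columnTables) where

    youngSymmetrizer⋆-antisymmetric : ∀ (F : Tensor 5) (X : Vector Carrierᴹ 5 → Fin 5 → Fin 5 → Carrier) →
      (X-antisym : ∀ v i j → X v j i ≈ - X v i j) →
      ∀ i j → (∀ v r → ⟦ F ⟧ (v ∘ᵥ r) ≈ X v (r ⟨$⟩ʳ i) (r ⟨$⟩ʳ j)) →
      (∀ v → ∑[ w ∈ rowTables ] D (X v) (X-antisym v) (Vec.lookup w i) (Vec.lookup w j) ≈ 0#) →
      youngSymmetrizer t ⋆ · F ≈ᵀ 0ᵀ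
    youngSymmetrizer⋆-antisymmetric F X X-antisym i j F≈X ∑D≈0 v = begin
      ⟦ youngSymmetrizer t ⋆ · F ⟧ v
        ≈⟨ youngSymmetrizer⋆-· t F v ⟩
      ∑[ p ∈ rowGroup t ] ∑[ q ∈ columnGroup t ] (sign q * ⟦ F ⟧ (v ∘ᵥ flip (p ∘′ q)))
        ≈⟨ ∑-cong (rowGroup t) (λ p → ∑-cong (columnGroup t) (λ q →
             *-congˡ {sign q} (F≈X v (flip (p ∘′ q))))) ⟩
      ∑[ p ∈ rowGroup t ] ∑[ q ∈ columnGroup t ]
        (sign q * X v (flip (p ∘′ q) ⟨$⟩ʳ i) (flip (p ∘′ q) ⟨$⟩ʳ j))
        ≈⟨ ∑-row-column (X v) (X-antisym v) t rows columns i j ⟩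
      ∑[ w ∈ rowTables ] D (X v) (X-antisym v) (Vec.lookup w i) (Vec.lookup w j)
        ≈⟨ ∑D≈0 v ⟩
      0# ∎

  module _ (T : Tensor 2) (U : Tensor 3)
           (alternating : ∀ r v → ⟦ T ⟧ (v ∘ᵥ r) ≈ sign (flip r) * ⟦ T ⟧ v)
           (symmetric   : ∀ r v → ⟦ U ⟧ (v ∘ᵥ r) ≈ ⟦ U ⟧ v) where

    -- The value of the product when T receives the arguments i and j. It is total: the diagonal has
    -- no such meaning, yet `X-antisym` holds there as well.
    X : Vector Carrierᴹ 5 → Fin 5 → Fin 5 → Carrier
    X v i j = ⟦ T ⟧ (v i ∷ᵥ v j ∷ᵥ []ᵥ) * ⟦ U ⟧ (v ∘ rest i j)

    X-antisym : ∀ v i j → X v j i ≈ - X v i j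
    X-antisym v i j = begin
      ⟦ T ⟧ (v j ∷ᵥ v i ∷ᵥ []ᵥ) * ⟦ U ⟧ (v ∘ rest j i)
        ≈⟨ *-cong (⟦⟧-cong-≡ T λ { 0F → ≡.refl ; 1F → ≡.refl })
                  (⟦⟧-cong-≡ U (λ k → ≡.cong v (rest-comm j i k))) ⟩
      ⟦ T ⟧ ((v i ∷ᵥ v j ∷ᵥ []ᵥ) ∘ᵥ transpose 0F 1F) * ⟦ U ⟧ (v ∘ rest i j)
        ≈⟨ *-congʳ (alternating (transpose 0F 1F) (v i ∷ᵥ v j ∷ᵥ []ᵥ)) ⟩
      - 1# * 1# * ⟦ T ⟧ (v i ∷ᵥ v j ∷ᵥ []ᵥ) * ⟦ U ⟧ (v ∘ rest i j)
        ≈⟨ *-congʳ (trans (*-congʳ (*-identityʳ _)) (-1*x≈-x _)) ⟩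
      - ⟦ T ⟧ (v i ∷ᵥ v j ∷ᵥ []ᵥ) * ⟦ U ⟧ (v ∘ rest i j)
        ≈⟨ -‿distribˡ-* _ _ ⟨
      - X v i j ∎

    ⊗-permute : ∀ v r → ⟦ T ⊗ U ⟧ (v ∘ᵥ r) ≈ X v (r ⟨$⟩ʳ 0F) (r ⟨$⟩ʳ 1F)
    ⊗-permute v r = *-cong
      (⟦⟧-cong-≡ T λ { 0F → ≡.refl ; 1F → ≡.refl })
      (trans (⟦⟧-cong-≡ U (λ k → ≡.cong v (rest-permutation r k)))
             (symmetric (remove 0F (remove 0F r)) (v ∘ rest (r ⟨$⟩ʳ 0F) (r ⟨$⟩ʳ 1F))))

    -- Commutativity of K turns `U ⊗ T` into `T ⊗ U` precomposed with `rotation`, which sends 0 and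
    -- 1 to 3 and 4.
    ⊗-permute′ : ∀ v r → ⟦ U ⊗ T ⟧ (v ∘ᵥ r) ≈ X v (r ⟨$⟩ʳ 3F) (r ⟨$⟩ʳ 4F)
    ⊗-permute′ v r = begin
      ⟦ U ⊗ T ⟧ (v ∘ᵥ r)
        ≈⟨ *-comm _ _ ⟩
      ⟦ T ⟧ ((v ∘ᵥ r) ∘ (3 ↑ʳ_)) * ⟦ U ⟧ ((v ∘ᵥ r) ∘ (_↑ˡ 2))
        ≈⟨ *-cong (⟦⟧-cong-≡ T λ { 0F → ≡.refl ; 1F → ≡.refl })
                  (⟦⟧-cong-≡ U λ { 0F → ≡.refl ; 1F → ≡.refl ; 2F → ≡.refl }) ⟩
      ⟦ T ⊗ U ⟧ (v ∘ᵥ (r ∘′ rotation))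
        ≈⟨ ⊗-permute v (r ∘′ rotation) ⟩
      X v (r ⟨$⟩ʳ 3F) (r ⟨$⟩ʳ 4F) ∎

    module _ {μ : Partition 5} (t : YoungTableau μ)
             (rows    : List.map inverseTable (rowGroup t) ≡ rowTables)
             (columns : List.map signedTable (columnGroup t) ≡ columnTables) where

      youngSymmetrizer⋆-alternating-⊗-symmetric : youngSymmetrizer t ⋆ · (T ⊗ U) ≈ᵀ 0ᵀ
      youngSymmetrizer⋆-alternating-⊗-symmetric = youngSymmetrizer⋆-antisymmetric t rows columns
        (T ⊗ U) X X-antisym 0F 1F ⊗-permute (λ v → ∑-D₀₁ (X v) (X-antisym v))

      youngSymmetrizer⋆-symmetric-⊗-alternating : youngSymmetrizer t ⋆ · (U ⊗ T) ≈ᵀ 0ᵀ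
      youngSymmetrizer⋆-symmetric-⊗-alternating = youngSymmetrizer⋆-antisymmetric t rows columns
        (U ⊗ T) X X-antisym 3F 4F ⊗-permute′ (λ v → ∑-D₃₄ (X v) (X-antisym v))

  -- Vanishing for inadmissible pairs

  module _ {ℓμ ℓν : Level} {λ₅ : Partition 5} (t : YoungTableau λ₅)
           (rows    : List.map inverseTable (rowGroup t) ≡ rowTables)
           (columns : List.map signedTable (columnGroup t) ≡ columnTables)
           (preservesRows₀₂ : PreservesRows t (transpose 0F 2F))
           (preservesRows₂₄ : PreservesRows t (transpose 2F 4F)) where

    oneColumn-vanishing : ∀ (ν : Partition 3) (J : IdealOf 3 ℓν) → OneColumn ν → HasClass J ν →
      ∀ (T : Tensor 2) (U : Tensor 3) → SymmetryClass J U →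
      (youngSymmetrizer t ⋆ · (T ⊗ U) ≈ᵀ 0ᵀ) × (youngSymmetrizer t ⋆ · (U ⊗ T) ≈ᵀ 0ᵀ)
    oneColumn-vanishing ν J ν₁₁₁ J-class T U U∈ =
        youngSymmetrizer⋆-⊗-alternating T U alternating t preservesRows₂₄
      , youngSymmetrizer⋆-alternating-⊗ T U alternating t preservesRows₀₂
      where
      alternating = oneColumn-alternating {μ = ν} {J} U ν₁₁₁ parityAdditive₃ J-class U∈

    oneColumn-oneRow-vanishing : ∀ (μ : Partition 2) (ν : Partition 3) → OneColumn μ → OneRow ν →
      ∀ (I : IdealOf 2 ℓμ) (J : IdealOf 3 ℓν) → HasClass I μ → HasClass J ν →
      ∀ (T : Tensor 2) (U : Tensor 3) → SymmetryClass I T → SymmetryClass J U →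
      (youngSymmetrizer t ⋆ · (T ⊗ U) ≈ᵀ 0ᵀ) × (youngSymmetrizer t ⋆ · (U ⊗ T) ≈ᵀ 0ᵀ)
    oneColumn-oneRow-vanishing μ ν μ₁₁ ν₃ I J I-class J-class T U T∈ U∈ =
        youngSymmetrizer⋆-alternating-⊗-symmetric T U alternating symmetric t rows columns
      , youngSymmetrizer⋆-symmetric-⊗-alternating T U alternating symmetric t rows columns
      where
      alternating = oneColumn-alternating {μ = μ} {I} T μ₁₁ parityAdditive₂ I-class T∈
      symmetric   = oneRow-symmetric {μ = ν} {J} U ν₃ J-class U∈

    inadmissible-vanishing : ∀ (μ : Partition 2) (ν : Partition 3) → ¬ AdmissiblePair μ ν →
      ∀ (I : IdealOf 2 ℓμ) (J : IdealOf 3 ℓν) → HasClass I μ → HasClass J ν →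
      ∀ (T : Tensor 2) (U : Tensor 3) → SymmetryClass I T → SymmetryClass J U →
      (youngSymmetrizer t ⋆ · (T ⊗ U) ≈ᵀ 0ᵀ) × (youngSymmetrizer t ⋆ · (U ⊗ T) ≈ᵀ 0ᵀ)
    inadmissible-vanishing μ ν inadmissible I J I-class J-class T U T∈ U∈ =
      [ (λ ν₁₁₁ → oneColumn-vanishing ν J ν₁₁₁ J-class T U U∈)
      , (λ (μ₁₁ , ν₃) → oneColumn-oneRow-vanishing μ ν μ₁₁ ν₃ I J I-class J-class T U T∈ U∈)
      ]′ (inadmissible-cases μ ν inadmissible)

-- Names of Defs are qualified from here on: an opened copy of _·_ agrees with the original only
-- after unfolding the sum over all 120 permutations, which is infeasible for a concrete tableau.
inadmissible-vanishing : ∀ {c ℓ₁ ℓ₂ m ℓm ℓμ ℓν : Level} (K : HeytingField c ℓ₁ ℓ₂)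
  (V : Module (commutativeRing K) m ℓm) {λ₅ : Partition 5} (t : YoungTableau λ₅) →
  List.map inverseTable (rowGroup t) ≡ rowTables →
  List.map signedTable (columnGroup t) ≡ columnTables →
  PreservesRows t (transpose 0F 2F) → PreservesRows t (transpose 2F 4F) →
  let y⋆ = GroupRing._⋆ K (GroupRing.youngSymmetrizer K t) in
  ∀ (μ : Partition 2) (ν : Partition 3) → ¬ AdmissiblePair μ ν →
  ∀ (I : GroupRing.IdealOf K 2 ℓμ) (J : GroupRing.IdealOf K 3 ℓν) →
  GroupRing.HasClass K I μ → GroupRing.HasClass K J ν →
  ∀ (T : Tensors.Tensor K V 2) (U : Tensors.Tensor K V 3) →
  Tensors.SymmetryClass K V I T → Tensors.SymmetryClass K V J U →
  Tensors._≈ᵀ_ K V (Tensors._·_ K V y⋆ (Tensors._⊗_ K V T U)) (Tensors.0ᵀ K V)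
    × Tensors._≈ᵀ_ K V (Tensors._·_ K V y⋆ (Tensors._⊗_ K V U T)) (Tensors.0ᵀ K V)
inadmissible-vanishing K V = TensorProperties.inadmissible-vanishing K V

theorem1p8 : ∀ {c ℓ₁ ℓ₂ ℓ₃ m ℓm ℓμ ℓν : Level}
    (K : HeytingField c ℓ₁ ℓ₂) → IsRealOrComplex K ℓ₃ →
    (V : Module (commutativeRing K) m ℓm) → Tensors.FiniteDimensional K V →
    let y⋆ = GroupRing._⋆ K (GroupRing.youngSymmetrizer K tableau-135-24)
    in
    (∀ (μ : Partition 2) (ν : Partition 3) → ¬ AdmissiblePair μ ν →
     ∀ (I : GroupRing.IdealOf K 2 ℓμ) (J : GroupRing.IdealOf K 3 ℓν) →
     GroupRing.IsMinimal K I → GroupRing.HasClass K I μ →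
     GroupRing.IsMinimal K J → GroupRing.HasClass K J ν →
     ∀ (T : Tensors.Tensor K V 2) (U : Tensors.Tensor K V 3) →
     Tensors.SymmetryClass K V I T → Tensors.SymmetryClass K V J U →
     Tensors._≈ᵀ_ K V (Tensors._·_ K V y⋆ (Tensors._⊗_ K V T U)) (Tensors.0ᵀ K V) ×
     Tensors._≈ᵀ_ K V (Tensors._·_ K V y⋆ (Tensors._⊗_ K V U T)) (Tensors.0ᵀ K V))
    ×
    (∀ (μ : Partition 2) (ν : Partition 3) →
     ∀ (I : GroupRing.IdealOf K 2 ℓμ) (J : GroupRing.IdealOf K 3 ℓν) →
     GroupRing.IsMinimal K I → GroupRing.HasClass K I μ →
     GroupRing.IsMinimal K J → GroupRing.HasClass K J ν →
     ∀ (T : Tensors.Tensor K V 2) (U : Tensors.Tensor K V 3) →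
     Tensors.SymmetryClass K V I T → Tensors.SymmetryClass K V J U →
     (Tensors.IsCovariantDerivativeCurvatureTensor K V (Tensors._·_ K V y⋆ (Tensors._⊗_ K V T U)) ×
      ¬ Tensors._≈ᵀ_ K V (Tensors._·_ K V y⋆ (Tensors._⊗_ K V T U)) (Tensors.0ᵀ K V))
       ⊎
     (Tensors.IsCovariantDerivativeCurvatureTensor K V (Tensors._·_ K V y⋆ (Tensors._⊗_ K V U T)) ×
      ¬ Tensors._≈ᵀ_ K V (Tensors._·_ K V y⋆ (Tensors._⊗_ K V U T)) (Tensors.0ᵀ K V)) →
     AdmissiblePair μ ν)
theorem1p8 {ℓμ = ℓμ} {ℓν = ℓν} K _ V _ =
    (λ μ ν inadmissible I J _ I-class _ J-class T U T∈ U∈ →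
      vanishing μ ν inadmissible I J I-class J-class T U T∈ U∈)
  , λ μ ν I J _ I-class _ J-class T U T∈ U∈ nonzero →
      -- If the pair were inadmissible, both products would vanish, contradicting either alternative
      -- of `nonzero`.
      decidable-stable (admissiblePair? μ ν) λ inadmissible →
        contradict (vanishing μ ν inadmissible I J I-class J-class T U T∈ U∈) nonzero
  where
  vanishing = inadmissible-vanishing {ℓμ = ℓμ} {ℓν} K V tableau-135-24
    rowGroup-tables columnGroup-tables preservesRows-transpose₀₂ preservesRows-transpose₂₄

  contradict : ∀ {a b a′ b′} {A : Set a} {B : Set b} {A′ : Set a′} {B′ : Set b′} →
               B × B′ → ¬ ((A × ¬ B) ⊎ (A′ × ¬ B′))
  contradict (b , _)  (inj₁ (_ , ¬b)) = ¬b b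
  contradict (_ , b′) (inj₂ (_ , ¬b)) = ¬b b′
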